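{- Let $C$ be an ordered field. The $\mathcal{L}_{\mathrm{Ham}}$-theory $T_{\mathrm{Ham}}$ of independent dense Hamel spaces over $C$ admits quantifier elimination and is complete.
   Context: A $2$-ordered $C$-vector space is a $C$-vector space $G$ with two linear orders $<_0,<_1$, each making $G$ an ordered $C$-vector space (ordered abelian group with $\lambda>0,x>0\Rightarrow\lambda x>0$ for $\lambda\in C$). Put $G_\infty=G\cup\{\infty\}$ with $\infty$ above $G$ in both orders. A Hamel valuation on $G$ is a map $v:G\to G_\infty$ such that for all $x,y\in G$, $\lambda\in C\setminus\{0\}$: $v(x)=\infty$ iff $x=0$; $v(x+y)\geq_0\min_0(v(x),v(y))$; $v(\lambda x)=v(x)$; if $0<_1x<_1y$ then $v(x)\geq_0v(y)$; $v(v(x))=v(x)$ (with $v(\infty)=\infty$); and $v(x)>_10$. A Hamel space is a pair $(G,v)$ of such. It is independent if for all $a_0,b_0,a_1,b_1\in G\cup\{\pm\infty\}$ with $a_0<_0b_0$, $a_1<_1b_1$ there is $z\in G$ with $a_0<_0z<_0b_0$ and $a_1<_1z<_1b_1$; it is dense if for all $a<_0b$ in $G$ there is $c\in G$ with $a<_0v(c)<_0b$. The language is $\mathcal{L}_{\mathrm{Ham}}=\{0,+,(\lambda_c)_{c\in C},<_0,<_1,v,\infty\}$; a Hamel space is an $\mathcal{L}_{\mathrm{Ham}}$-structure with universe $G_\infty$, $\lambda_c$ scalar multiplication by $c$, and $g+\infty=\infty+g=\infty+\infty=\lambda_c(\infty)=v(\infty)=\infty$. $T_{\mathrm{Ham}}$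 is the theory whose models are exactly the independent dense Hamel spaces over $C$. -}

module Defs where

open import Level using (Level; _⊔_) renaming (suc to lsuc)
open import Data.Nat using (ℕ) renaming (suc to nsuc)
open import Data.Fin using (Fin; zero; suc)
open import Data.Product using (Σ; _×_; _,_)
open import Data.Sum using (_⊎_)
open import Data.Empty using (⊥)
open import Data.Unit.Polymorphic using (⊤)
open import Relation.Nullary using (¬_)
open import Relation.Binary.PropositionalEquality using (_≡_)
open import Relation.Binary.Structures using (IsStrictTotalOrder)
open import Relation.Binary.Definitions using (tri<; tri≈; tri>)
open import Algebra.Structures using (IsCommutativeRing; IsAbelianGroup)

record OrderedField (c : Level) : Set (lsuc c) where
  infixl 6 _+_
  infixl 7 _*_
  infix 4 _<_
  field
    Carrier : Set c
    _+_ _*_ : Carrier → Carrier → Carrier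
    -_      : Carrier → Carrier
    0# 1#   : Carrier
    _<_     : Carrier → Carrier → Set c
    isCommutativeRing  : IsCommutativeRing _≡_ _+_ _*_ -_ 0# 1#
    0≢1                : ¬ (0# ≡ 1#)
    inverse            : ∀ x → ¬ (x ≡ 0#) → Σ Carrier λ y → x * y ≡ 1#
    isStrictTotalOrder : IsStrictTotalOrder _≡_ _<_
    +-mono-<           : ∀ x y z → x < y → x + z < y + z
    *-pos              : ∀ x y → 0# < x → 0# < y → 0# < x * y

data Ext∞ {g} (G : Set g) : Set g where
  ↑_ : G → Ext∞ G
  ∞  : Ext∞ G

data Ext± {g} (G : Set g) : Set g where
  -∞   : Ext± G
  ⟨_⟩  : G → Ext± G
  +∞   : Ext± G

module _ {g} {G : Set g} (_<_ : G → G → Set g) where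

  data Lift< : Ext∞ G → Ext∞ G → Set g where
    fin<fin : ∀ {x y} → x < y → Lift< (↑ x) (↑ y)
    fin<∞   : ∀ {x} → Lift< (↑ x) ∞

  Lift≤ : Ext∞ G → Ext∞ G → Set g
  Lift≤ a b = Lift< a b ⊎ a ≡ b

  data Lift±< : Ext± G → Ext± G → Set g where
    -∞<fin : ∀ {x} → Lift±< -∞ ⟨ x ⟩
    -∞<+∞  : Lift±< -∞ +∞
    fin<fin : ∀ {x y} → x < y → Lift±< ⟨ x ⟩ ⟨ y ⟩
    fin<+∞ : ∀ {x} → Lift±< ⟨ x ⟩ +∞

  below : Ext± G → G → Set g
  below a z = Lift±< a ⟨ z ⟩

  above : G → Ext± G → Set g
  above z b = Lift±< ⟨ z ⟩ b

min∞ : ∀ {g} {G : Set g} {_<_ : G → G → Set g} →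
       IsStrictTotalOrder _≡_ _<_ → Ext∞ G → Ext∞ G → Ext∞ G
min∞ sto ∞     b     = b
min∞ sto (↑ x) ∞     = ↑ x
min∞ sto (↑ x) (↑ y) with IsStrictTotalOrder.compare sto x y
... | tri< _ _ _ = ↑ x
... | tri≈ _ _ _ = ↑ x
... | tri> _ _ _ = ↑ y

ext : ∀ {g} {G : Set g} → (G → Ext∞ G) → Ext∞ G → Ext∞ G
ext v (↑ x) = v x
ext v ∞     = ∞

module _ {c} (C : OrderedField c) where
  private module C = OrderedField C

  record HamelSpace (g : Level) : Set (c ⊔ lsuc g) where
    infixl 6 _⊕_
    infixr 7 _·_
    infix 4 _<₀_ _<₁_
    field
      G     : Set g
      _⊕_   : G → G → G
      ⊖_    : G → G
      0g    : G
      _·_   : C.Carrier → G → G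
      isAbelianGroup : IsAbelianGroup _≡_ _⊕_ 0g ⊖_
      ·-distribˡ : ∀ (a : C.Carrier) x y → a · (x ⊕ y) ≡ a · x ⊕ a · y
      ·-distribʳ : ∀ (a b : C.Carrier) x → (a C.+ b) · x ≡ a · x ⊕ b · x
      ·-assoc    : ∀ (a b : C.Carrier) x → (a C.* b) · x ≡ a · (b · x)
      ·-identity : ∀ x → C.1# · x ≡ x
      _<₀_ _<₁_ : G → G → Set g
      sto₀ : IsStrictTotalOrder _≡_ _<₀_
      sto₁ : IsStrictTotalOrder _≡_ _<₁_
      ⊕-mono-<₀ : ∀ x y z → x <₀ y → x ⊕ z <₀ y ⊕ z
      ⊕-mono-<₁ : ∀ x y z → x <₁ y → x ⊕ z <₁ y ⊕ z
      ·-pos₀ : ∀ (a : C.Carrier) x → C.0# C.< a → 0g <₀ x → 0g <₀ a · x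
      ·-pos₁ : ∀ (a : C.Carrier) x → C.0# C.< a → 0g <₁ x → 0g <₁ a · x
      v : G → Ext∞ G
      v-∞     : ∀ x → (v x ≡ ∞ → x ≡ 0g) × (x ≡ 0g → v x ≡ ∞)
      v-ultra : ∀ x y → Lift≤ _<₀_ (min∞ sto₀ (v x) (v y)) (v (x ⊕ y))
      v-scal  : ∀ (a : C.Carrier) x → ¬ (a ≡ C.0#) → v (a · x) ≡ v x
      v-mono  : ∀ x y → 0g <₁ x → x <₁ y → Lift≤ _<₀_ (v y) (v x)
      v-idem  : ∀ x → ext v (v x) ≡ v x
      v-pos   : ∀ x → Lift< _<₁_ (↑ 0g) (v x)

    Independent : Set g
    Independent = ∀ (a₀ b₀ a₁ b₁ : Ext± G) →
      Lift±< _<₀_ a₀ b₀ → Lift±< _<₁_ a₁ b₁ →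
      Σ G λ z → (below _<₀_ a₀ z × above _<₀_ z b₀)
              × (below _<₁_ a₁ z × above _<₁_ z b₁)

    Dense : Set g
    Dense = ∀ a b → a <₀ b →
      Σ G λ c → Lift< _<₀_ (↑ a) (v c) × Lift< _<₀_ (v c) (↑ b)

    _⊕∞_ : Ext∞ G → Ext∞ G → Ext∞ G
    (↑ x) ⊕∞ (↑ y) = ↑ (x ⊕ y)
    (↑ x) ⊕∞ ∞     = ∞
    ∞     ⊕∞ _     = ∞

    scal∞ : C.Carrier → Ext∞ G → Ext∞ G
    scal∞ a (↑ x) = ↑ (a · x)
    scal∞ a ∞     = ∞

  record IndepDenseHamel (g : Level) : Set (c ⊔ lsuc g) where
    field
      space       : HamelSpace g
      independent : HamelSpace.Independent space
      dense       : HamelSpace.Dense space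
    open HamelSpace space public

  data Term (n : ℕ) : Set c where
    var  : Fin n → Term n
    𝟘    : Term n
    ∞ₜ   : Term n
    _⊞_  : Term n → Term n → Term n
    λ[_] : C.Carrier → Term n → Term n
    vₜ   : Term n → Term n

  data Formula : ℕ → Set c where
    ⊤ᶠ ⊥ᶠ    : ∀ {n} → Formula n
    _≐_      : ∀ {n} → Term n → Term n → Formula n
    _≺₀_ _≺₁_ : ∀ {n} → Term n → Term n → Formula n
    ¬ᶠ_      : ∀ {n} → Formula n → Formula n
    _∧ᶠ_ _∨ᶠ_ _⇒ᶠ_ : ∀ {n} → Formula n → Formula n → Formula n
    ∃ᶠ ∀ᶠ    : ∀ {n} → Formula (nsuc n) → Formula n

  data QuantifierFree : ∀ {n} → Formula n → Set c where
    ⊤ᶠ  : ∀ {n} → QuantifierFree (⊤ᶠ {n})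
    ⊥ᶠ  : ∀ {n} → QuantifierFree (⊥ᶠ {n})
    _≐_ : ∀ {n} (t s : Term n) → QuantifierFree (t ≐ s)
    _≺₀_ : ∀ {n} (t s : Term n) → QuantifierFree (t ≺₀ s)
    _≺₁_ : ∀ {n} (t s : Term n) → QuantifierFree (t ≺₁ s)
    ¬ᶠ_ : ∀ {n} {φ : Formula n} → QuantifierFree φ → QuantifierFree (¬ᶠ φ)
    _∧ᶠ_ : ∀ {n} {φ ψ : Formula n} → QuantifierFree φ → QuantifierFree ψ → QuantifierFree (φ ∧ᶠ ψ)
    _∨ᶠ_ : ∀ {n} {φ ψ : Formula n} → QuantifierFree φ → QuantifierFree ψ → QuantifierFree (φ ∨ᶠ ψ)
    _⇒ᶠ_ : ∀ {n} {φ ψ : Formula n} → QuantifierFree φ → QuantifierFree ψ → QuantifierFree (φ ⇒ᶠ ψ)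

  module Semantics {g} (M : HamelSpace g) where
    open HamelSpace M

    cons : ∀ {n} → Ext∞ G → (Fin n → Ext∞ G) → Fin (nsuc n) → Ext∞ G
    cons a ρ zero    = a
    cons a ρ (suc i) = ρ i

    evalₜ : ∀ {n} → (Fin n → Ext∞ G) → Term n → Ext∞ G
    evalₜ ρ (var i)   = ρ i
    evalₜ ρ 𝟘         = ↑ 0g
    evalₜ ρ ∞ₜ        = ∞
    evalₜ ρ (t ⊞ s)   = evalₜ ρ t ⊕∞ evalₜ ρ s
    evalₜ ρ (λ[ a ] t) = scal∞ a (evalₜ ρ t)
    evalₜ ρ (vₜ t)    = ext v (evalₜ ρ t)

    Sat : ∀ {n} → (Fin n → Ext∞ G) → Formula n → Set g
    Sat ρ ⊤ᶠ        = ⊤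
    Sat ρ ⊥ᶠ        = Level.Lift g ⊥
    Sat ρ (t ≐ s)   = evalₜ ρ t ≡ evalₜ ρ s
    Sat ρ (t ≺₀ s)  = Lift< _<₀_ (evalₜ ρ t) (evalₜ ρ s)
    Sat ρ (t ≺₁ s)  = Lift< _<₁_ (evalₜ ρ t) (evalₜ ρ s)
    Sat ρ (¬ᶠ φ)    = ¬ Sat ρ φ
    Sat ρ (φ ∧ᶠ ψ)  = Sat ρ φ × Sat ρ ψ
    Sat ρ (φ ∨ᶠ ψ)  = Sat ρ φ ⊎ Sat ρ ψ
    Sat ρ (φ ⇒ᶠ ψ)  = Sat ρ φ → Sat ρ ψ
    Sat ρ (∃ᶠ φ)    = Σ (Ext∞ G) λ a → Sat (cons a ρ) φ
    Sat ρ (∀ᶠ φ)    = ∀ (a : Ext∞ G) → Sat (cons a ρ) φ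

  _⊨_[_] : ∀ {g n} (M : IndepDenseHamel g) → Formula n →
           (Fin n → Ext∞ (IndepDenseHamel.G M)) → Set g
  M ⊨ φ [ ρ ] = Semantics.Sat (IndepDenseHamel.space M) ρ φ

  T-Ham⊨ : (g : Level) → Formula 0 → Set (c ⊔ lsuc g)
  T-Ham⊨ g φ = ∀ (M : IndepDenseHamel g) → M ⊨ φ [ (λ ()) ]

  QuantifierElimination : (g : Level) → Set (c ⊔ lsuc g)
  QuantifierElimination g = ∀ {n} (φ : Formula n) →
    Σ (Formula n) λ ψ → QuantifierFree ψ ×
      (∀ (M : IndepDenseHamel g) (ρ : Fin n → Ext∞ (IndepDenseHamel.G M)) →
         (M ⊨ φ [ ρ ] → M ⊨ ψ [ ρ ]) × (M ⊨ ψ [ ρ ] → M ⊨ φ [ ρ ]))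

  Complete : (g : Level) → Set (c ⊔ lsuc g)
  Complete g = ∀ (φ : Formula 0) → T-Ham⊨ g φ ⊎ T-Ham⊨ g (¬ᶠ φ)

{-# OPTIONS --safe #-}

-- Both orders come with a decidable trichotomy, so quantifier-free formulas are decidable and it is
-- enough to eliminate one quantifier ∃ x from a quantifier-free formula φ, uniformly in all models.
--
-- Every innermost term v(c x + s) with c ≠ 0 equals v(x - a) with a free of x. Naming the values
-- w = v(x - a) one after the other turns ∃ x φ into ∃ w₁ … ∃ wₖ ∃ x (⋀ v(x - aⱼ) = wⱼ ∧ ψ), where x
-- is not under any v in ψ, so that only its two cuts among finitely many parameters matter to ψ.
--
-- Eliminating x: away from the parameters, the conditions v(x - aⱼ) = wⱼ are clopen for <₁ and do not
-- involve <₀, so by independence the two cuts can be prescribed separately. For <₀ the cuts just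
-- above a parameter and at -∞ suffice. For <₁ take w maximal among the wⱼ: some point among the
-- midpoints of two parameters and the translates of parameters by ± w realises the same cut and
-- the same valuations as x.
--
-- Eliminating a value w: v(w - a) is w or v(a) unless w = v(a), and the <₁-cut of w is
-- determined by its <₀-cut, so ∃ w only asks for a value in some <₀-interval, and values are dense.

module Submission where

-- The obstacle is that `v` may be nested around `x` and takes its values in the sort of `x`, so
-- naming a value introduces a new quantifier over the group. There is no circle: a quantifier over
-- values is eliminated without naming further values, because `v(w - a)` is rewritten as `w` or as
-- a term free of `w`. The recursion is therefore structural in the named values.
--
-- The same feature makes the translates by `± w` possible. A finite value is an element of the
-- group with `v(w) = w` and `0 <₁ w`, so it serves as a step of exactly that valuation. The maximal
-- `w` belongs to a parameter nearest to `x`, and only there could a replacement of `x` change a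
-- valuation by cancellation. A formula cannot tell in advance which `w` is maximal, so all are
-- tried, and every test point is checked inside the formula. Soundness thus does not depend on how
-- the test points were found; their choice matters only for the converse.
--
-- Completeness follows because a closed term is `0` or `∞` in every model: the truth value of a
-- quantifier-free sentence is computed without looking at a model.

open import Defs
open import Level using (Level; _⊔_)
open import Algebra.Bundles using (AbelianGroup; CommutativeRing)
import Algebra.Properties.AbelianGroup
import Algebra.Properties.Ring
import Algebra.Solver.CommutativeMonoid.Normal
open import Data.Bool using (Bool; true; false; if_then_else_; not; _∧_; T; T?)
open import Data.Bool.Properties using (T-∧)
open import Data.Empty using (⊥-elim)
open import Data.Fin using (Fin; zero; suc)
open import Data.List using (List; []; _∷_; _++_; map; concatMap)
import Data.List.Membership.DecPropositional
open import Data.List.Membership.Propositional using (_∈_; lose)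
open import Data.List.Membership.Propositional.Properties
  using (∈-++⁺ˡ; ∈-++⁺ʳ; ∈-concatMap⁺; ∈-map⁺; ∈-map⁻)
open import Data.List.Relation.Unary.All as All using (All; []; _∷_)
import Data.List.Relation.Unary.All.Properties as All
open import Data.List.Relation.Unary.Any using (here; there)
open import Data.Nat using (ℕ; suc)
open import Data.Product using (Σ; _×_; _,_; proj₁; proj₂)
open import Data.Sum using (_⊎_; inj₁; inj₂; [_,_]′; swap)
open import Data.Unit using (⊤)
open import Data.Vec as Vec using (Vec)
open import Data.Vec.N-ary using (N-ary; Eq; curryⁿ; curryⁿ-cong; _$ⁿ_)
open import Function using (_∘_; id; Equivalence)
import Relation.Binary.Construct.Flip.EqAndOrd as Flip
open import Relation.Binary.Definitions using (Tri; tri<; tri≈; tri>; Trichotomous)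
open import Relation.Binary.PropositionalEquality
  using (_≡_; refl; sym; trans; cong; cong₂; subst; subst₂)
open import Relation.Binary.Structures using (IsStrictTotalOrder)
open import Relation.Nullary using (¬_; Dec; yes; no)
open import Relation.Nullary.Decidable using (map′; isYes; toWitness; fromWitness)

-- Boolean formulas

infixr 6 _&_
infixr 5 _or_
infix 7 ~_

data BF {a} (A : Set a) : Set a where
  at   : A → BF A
  true : BF A
  _&_  : BF A → BF A → BF A
  ~_   : BF A → BF A

_or_ : ∀ {a} {A : Set a} → BF A → BF A → BF A
φ or ψ = ~ (~ φ & ~ ψ)

ite : ∀ {a} {A : Set a} → BF A → BF A → BF A → BF A
ite β φ ψ = (β & φ) or (~ β & ψ)

any all : ∀ {a b} {A : Set a} {B : Set b} → List B → (B → BF A) → BF A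
any []       k = ~ true
any (b ∷ bs) k = k b or any bs k
all []       k = true
all (b ∷ bs) k = k b & all bs k

infixl 4 _>>=_
_>>=_ : ∀ {a b} {A : Set a} {B : Set b} → BF A → (A → BF B) → BF B
at x    >>= k = k x
true    >>= k = true
(φ & ψ) >>= k = (φ >>= k) & (ψ >>= k)
(~ φ)   >>= k = ~ (φ >>= k)

atoms : ∀ {a} {A : Set a} → BF A → List A
atoms (at x)  = x ∷ []
atoms true    = []
atoms (φ & ψ) = atoms φ ++ atoms ψ
atoms (~ φ)   = atoms φ

eval : ∀ {a} {A : Set a} → (A → Bool) → BF A → Bool
eval f (at x)  = f x
eval f true    = true
eval f (φ & ψ) = eval f φ ∧ eval f ψ
eval f (~ φ)   = not (eval f φ)

eval->>= : ∀ {a b} {A : Set a} {B : Set b} (f : B → Bool) (φ : BF A) (k : A → BF B) →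
  eval f (φ >>= k) ≡ eval (eval f ∘ k) φ
eval->>= f (at x)  k = refl
eval->>= f true    k = refl
eval->>= f (φ & ψ) k = cong₂ _∧_ (eval->>= f φ k) (eval->>= f ψ k)
eval->>= f (~ φ)   k = cong not (eval->>= f φ k)

-- Agreement is asked only at the atoms that occur: a test point imitates `x` only with respect to
-- the finitely many terms collected from the formula.
eval-cong : ∀ {a} {A : Set a} {f g : A → Bool} (φ : BF A) →
  (∀ x → x ∈ atoms φ → f x ≡ g x) → eval f φ ≡ eval g φ
eval-cong (at x)  e = e x (here refl)
eval-cong true    e = refl
eval-cong (φ & ψ) e = cong₂ _∧_ (eval-cong φ λ x → e x ∘ ∈-++⁺ˡ)
                                (eval-cong ψ λ x → e x ∘ ∈-++⁺ʳ (atoms φ))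
eval-cong (~ φ)   e = cong not (eval-cong φ e)

T-≡ : ∀ {b c} → b ≡ c → T b → T c
T-≡ refl t = t

T-bool : ∀ {b c} → (T b → T c) → (T c → T b) → b ≡ c
T-bool {false} {false} _ _ = refl
T-bool {false} {true}  _ g = ⊥-elim (g _)
T-bool {true}  {false} f _ = ⊥-elim (f _)
T-bool {true}  {true}  _ _ = refl

T-stable : ∀ {b} → ¬ ¬ T b → T b
T-stable {true}  _ = _
T-stable {false} n = ⊥-elim (n λ t → t)

module _ {a} {A : Set a} (f : A → Bool) where

  private
    ⟦_⟧ : BF A → Set
    ⟦ φ ⟧ = T (eval f φ)

  ~-intro : ∀ φ → ¬ ⟦ φ ⟧ → ⟦ ~ φ ⟧
  ~-intro φ n with eval f φ
  ... | true  = n _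
  ... | false = _

  ~-elim : ∀ φ → ⟦ ~ φ ⟧ → ¬ ⟦ φ ⟧
  ~-elim φ n t with eval f φ
  ~-elim φ () t | true

  &-intro : ∀ φ ψ → ⟦ φ ⟧ → ⟦ ψ ⟧ → ⟦ φ & ψ ⟧
  &-intro φ ψ p q = Equivalence.from T-∧ (p , q)

  &-elim : ∀ φ ψ → ⟦ φ & ψ ⟧ → ⟦ φ ⟧ × ⟦ ψ ⟧
  &-elim φ ψ = Equivalence.to T-∧

  or-introˡ : ∀ φ ψ → ⟦ φ ⟧ → ⟦ φ or ψ ⟧
  or-introˡ φ ψ p = ~-intro (~ φ & ~ ψ) λ n → ~-elim φ (proj₁ (&-elim (~ φ) (~ ψ) n)) p

  or-introʳ : ∀ φ ψ → ⟦ ψ ⟧ → ⟦ φ or ψ ⟧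
  or-introʳ φ ψ p = ~-intro (~ φ & ~ ψ) λ n → ~-elim ψ (proj₂ (&-elim (~ φ) (~ ψ) n)) p

  or-elim : ∀ φ ψ → ⟦ φ or ψ ⟧ → ⟦ φ ⟧ ⊎ ⟦ ψ ⟧
  or-elim φ ψ t with eval f φ | eval f ψ
  ... | true  | _    = inj₁ _
  ... | false | true = inj₂ _

  ite-true : ∀ β φ ψ → ⟦ β ⟧ → eval f (ite β φ ψ) ≡ eval f φ
  ite-true β φ ψ t with eval f β | eval f φ
  ... | true | true  = refl
  ... | true | false = refl

  ite-false : ∀ β φ ψ → ¬ ⟦ β ⟧ → eval f (ite β φ ψ) ≡ eval f ψ
  ite-false β φ ψ n with eval f β | eval f ψ
  ... | true  | _     = ⊥-elim (n _)
  ... | false | true  = refl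
  ... | false | false = refl

  module _ {b} {B : Set b} where

    any-intro : ∀ {bs : List B} {k b} → b ∈ bs → ⟦ k b ⟧ → ⟦ any bs k ⟧
    any-intro {c ∷ cs} {k} (here refl) t = or-introˡ (k c) (any cs k) t
    any-intro {c ∷ cs} {k} (there i)   t = or-introʳ (k c) (any cs k) (any-intro i t)

    any-elim : ∀ (bs : List B) {k} → ⟦ any bs k ⟧ → Σ B λ b → b ∈ bs × ⟦ k b ⟧
    any-elim (c ∷ cs) {k} t with or-elim (k c) (any cs k) t
    ... | inj₁ u = c , here refl , u
    ... | inj₂ u with any-elim cs u
    ...   | b , i , w = b , there i , w

    all-intro : ∀ (bs : List B) {k} → (∀ b → b ∈ bs → ⟦ k b ⟧) → ⟦ all bs k ⟧
    all-intro []       h = _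
    all-intro (c ∷ cs) {k} h =
      &-intro (k c) (all cs k) (h c (here refl)) (all-intro cs λ b → h b ∘ there)

    all-elim : ∀ {bs : List B} {k} → ⟦ all bs k ⟧ → ∀ b → b ∈ bs → ⟦ k b ⟧
    all-elim {c ∷ cs} {k} t b (here refl) = proj₁ (&-elim (k c) (all cs k) t)
    all-elim {c ∷ cs} {k} t b (there i)   = all-elim (proj₂ (&-elim (k c) (all cs k) t)) b i

-- Equations in abelian groups

module AbelianGroupSolver {a ℓ} (𝔾 : AbelianGroup a ℓ) where
  open AbelianGroup 𝔾
    renaming (refl to ≈-refl; sym to ≈-sym; trans to ≈-trans)
    hiding (_-_)
  open Algebra.Properties.AbelianGroup 𝔾 using (∙-cancelʳ)
  private
    module N = Algebra.Solver.CommutativeMonoid.Normal commutativeMonoid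

  infixl 6 _:+_ _:-_
  infix 7 :-_

  data Expr (n : ℕ) : Set where
    var  : Fin n → Expr n
    :0   : Expr n
    _:+_ : Expr n → Expr n → Expr n
    :-_  : Expr n → Expr n

  _:-_ : ∀ {n} → Expr n → Expr n → Expr n
  e :- e′ = e :+ (:- e′)

  ⟦_⟧ : ∀ {n} → Expr n → Vec Carrier n → Carrier
  ⟦ var i ⟧ ρ = Vec.lookup ρ i
  ⟦ :0 ⟧ ρ = ε
  ⟦ e :+ e′ ⟧ ρ = ⟦ e ⟧ ρ ∙ ⟦ e′ ⟧ ρ
  ⟦ :- e ⟧ ρ = ⟦ e ⟧ ρ ⁻¹

  -- An expression is the difference of these two parts, each free of inverses. Moving the negative
  -- parts across turns an equation of abelian groups into one of commutative monoids, which is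
  -- decided by normal forms.
  positive negative : ∀ {n} → Expr n → N.Expr n
  positive (var i)   = N.var i
  positive :0        = N.id
  positive (e :+ e′) = positive e N.⊕ positive e′
  positive (:- e)    = negative e
  negative (var i)   = N.id
  negative :0        = N.id
  negative (e :+ e′) = negative e N.⊕ negative e′
  negative (:- e)    = positive e

  open import Relation.Binary.Reasoning.Setoid setoid
  open import Algebra.Properties.CommutativeSemigroup commutativeSemigroup using (interchange)

  split : ∀ {n} (e : Expr n) ρ → ⟦ e ⟧ ρ ∙ N.⟦ negative e ⟧ ρ ≈ N.⟦ positive e ⟧ ρ
  split (var i) ρ = identityʳ _
  split :0 ρ = identityʳ _
  split (e :+ e′) ρ = ≈-trans (interchange _ _ _ _) (∙-cong (split e ρ) (split e′ ρ))
  split (:- e) ρ = begin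
    ⟦ e ⟧ ρ ⁻¹ ∙ N.⟦ positive e ⟧ ρ                  ≈⟨ ∙-congˡ (split e ρ) ⟨
    ⟦ e ⟧ ρ ⁻¹ ∙ (⟦ e ⟧ ρ ∙ N.⟦ negative e ⟧ ρ)      ≈⟨ assoc _ _ _ ⟨
    ⟦ e ⟧ ρ ⁻¹ ∙ ⟦ e ⟧ ρ ∙ N.⟦ negative e ⟧ ρ        ≈⟨ ∙-congʳ (inverseˡ _) ⟩
    ε ∙ N.⟦ negative e ⟧ ρ                           ≈⟨ identityˡ _ ⟩
    N.⟦ negative e ⟧ ρ                               ∎

  sides : ∀ {n} → Expr n → Expr n → N.Normal n × N.Normal n
  sides e e′ = N.normalise (positive e N.⊕ negative e′) , N.normalise (positive e′ N.⊕ negative e)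

  prove : ∀ {n} (e e′ : Expr n) → proj₁ (sides e e′) ≡ proj₂ (sides e e′) → ∀ ρ → ⟦ e ⟧ ρ ≈ ⟦ e′ ⟧ ρ
  prove e e′ eq ρ = ∙-cancelʳ (N.⟦ negative e ⟧ ρ ∙ N.⟦ negative e′ ⟧ ρ) _ _ (begin
    ⟦ e ⟧ ρ ∙ (N.⟦ negative e ⟧ ρ ∙ N.⟦ negative e′ ⟧ ρ)    ≈⟨ assoc _ _ _ ⟨
    ⟦ e ⟧ ρ ∙ N.⟦ negative e ⟧ ρ ∙ N.⟦ negative e′ ⟧ ρ      ≈⟨ ∙-congʳ (split e ρ) ⟩
    N.⟦ positive e ⟧ ρ ∙ N.⟦ negative e′ ⟧ ρ                ≈⟨ N.correct (positive e N.⊕ negative e′) ρ ⟨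
    N.⟦ proj₁ (sides e e′) ⟧⇓ ρ                             ≡⟨ cong (λ s → N.⟦ s ⟧⇓ ρ) eq ⟩
    N.⟦ proj₂ (sides e e′) ⟧⇓ ρ                             ≈⟨ N.correct (positive e′ N.⊕ negative e) ρ ⟩
    N.⟦ positive e′ ⟧ ρ ∙ N.⟦ negative e ⟧ ρ                ≈⟨ ∙-congʳ (split e′ ρ) ⟨
    ⟦ e′ ⟧ ρ ∙ N.⟦ negative e′ ⟧ ρ ∙ N.⟦ negative e ⟧ ρ     ≈⟨ assoc _ _ _ ⟩
    ⟦ e′ ⟧ ρ ∙ (N.⟦ negative e′ ⟧ ρ ∙ N.⟦ negative e ⟧ ρ)   ≈⟨ ∙-congˡ (comm _ _) ⟩
    ⟦ e′ ⟧ ρ ∙ (N.⟦ negative e ⟧ ρ ∙ N.⟦ negative e′ ⟧ ρ)   ∎)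

  close : ∀ n → N-ary n (Expr n) (Expr n × Expr n) → Expr n × Expr n
  close n f = f $ⁿ Vec.map var (Vec.allFin n)

  solve : ∀ n (f : N-ary n (Expr n) (Expr n × Expr n)) →
    proj₁ (sides (proj₁ (close n f)) (proj₂ (close n f))) ≡
    proj₂ (sides (proj₁ (close n f)) (proj₂ (close n f))) →
    Eq n _≈_ (curryⁿ ⟦ proj₁ (close n f) ⟧) (curryⁿ ⟦ proj₂ (close n f) ⟧)
  solve n f eq = curryⁿ-cong _≈_ ⟦ proj₁ (close n f) ⟧ ⟦ proj₂ (close n f) ⟧
    (prove (proj₁ (close n f)) (proj₂ (close n f)) eq)

  infix 4 _:=_
  _:=_ : ∀ {n} → Expr n → Expr n → Expr n × Expr n
  _:=_ = _,_

-- Strict total orders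

↑-injective : ∀ {g} {G : Set g} {x y : G} → ↑ x ≡ ↑ y → x ≡ y
↑-injective refl = refl

module ExtendedOrder {g} {G : Set g} {_<_ : G → G → Set g} (sto : IsStrictTotalOrder _≡_ _<_) where
  private
    module O = IsStrictTotalOrder sto

  infix 4 _<∞_ _≤∞_
  _<∞_ _≤∞_ : Ext∞ G → Ext∞ G → Set g
  _<∞_ = Lift< _<_
  _≤∞_ = Lift≤ _<_

  <∞-irrefl : ∀ {a} → ¬ a <∞ a
  <∞-irrefl (fin<fin p) = O.irrefl refl p

  <∞-trans : ∀ {a b c} → a <∞ b → b <∞ c → a <∞ c
  <∞-trans (fin<fin p) (fin<fin q) = fin<fin (O.trans p q)
  <∞-trans (fin<fin p) fin<∞       = fin<∞

  compare∞ : Trichotomous _≡_ _<∞_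
  compare∞ (↑ x) (↑ y) with O.compare x y
  ... | tri< p ¬q ¬r = tri< (fin<fin p) (¬q ∘ ↑-injective) λ { (fin<fin r) → ¬r r }
  ... | tri≈ ¬p q ¬r = tri≈ (λ { (fin<fin p) → ¬p p }) (cong ↑_ q) λ { (fin<fin r) → ¬r r }
  ... | tri> ¬p ¬q r = tri> (λ { (fin<fin p) → ¬p p }) (¬q ∘ ↑-injective) (fin<fin r)
  compare∞ (↑ x) ∞ = tri< fin<∞ (λ ()) (λ ())
  compare∞ ∞ (↑ x) = tri> (λ ()) (λ ()) fin<∞
  compare∞ ∞ ∞ = tri≈ (λ ()) refl (λ ())

  infix 4 _<∞?_
  _<∞?_ : ∀ a b → Dec (a <∞ b)
  a <∞? b with compare∞ a b
  ... | tri< p _ _  = yes p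
  ... | tri≈ ¬p _ _ = no ¬p
  ... | tri> ¬p _ _ = no ¬p

  ≤∞-trans : ∀ {a b c} → a ≤∞ b → b ≤∞ c → a ≤∞ c
  ≤∞-trans (inj₁ p)    (inj₁ q)    = inj₁ (<∞-trans p q)
  ≤∞-trans (inj₁ p)    (inj₂ refl) = inj₁ p
  ≤∞-trans (inj₂ refl) q           = q

  <-≤∞-trans : ∀ {a b c} → a <∞ b → b ≤∞ c → a <∞ c
  <-≤∞-trans p (inj₁ q)    = <∞-trans p q
  <-≤∞-trans p (inj₂ refl) = p

  ≤-<∞-trans : ∀ {a b c} → a ≤∞ b → b <∞ c → a <∞ c
  ≤-<∞-trans (inj₁ p)    q = <∞-trans p q
  ≤-<∞-trans (inj₂ refl) q = q

  ≤∞-antisym : ∀ {a b} → a ≤∞ b → b ≤∞ a → a ≡ b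
  ≤∞-antisym (inj₁ p)    (inj₁ q)    = ⊥-elim (<∞-irrefl (<∞-trans p q))
  ≤∞-antisym (inj₁ p)    (inj₂ refl) = refl
  ≤∞-antisym (inj₂ refl) q           = refl

  ≮∞⇒≥∞ : ∀ {a b} → ¬ a <∞ b → b ≤∞ a
  ≮∞⇒≥∞ {a} {b} n with compare∞ a b
  ... | tri< p _ _ = ⊥-elim (n p)
  ... | tri≈ _ q _ = inj₂ (sym q)
  ... | tri> _ _ r = inj₁ r

  min∞-glb : ∀ {c} a b → c ≤∞ a → c ≤∞ b → c ≤∞ min∞ sto a b
  min∞-glb ∞     b p q = q
  min∞-glb (↑ x) ∞ p q = p
  min∞-glb (↑ x) (↑ y) p q with O.compare x y
  ... | tri< _ _ _ = p
  ... | tri≈ _ _ _ = p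
  ... | tri> _ _ _ = q

-- `Sep x L S` says that x realises the cut of S immediately above L.
module Cuts {g} {G : Set g} {_<_ : G → G → Set g} (sto : IsStrictTotalOrder _≡_ _<_) where
  private
    module O = IsStrictTotalOrder sto

  Sep : G → Ext± G → List G → Set g
  Sep x L S = ∀ r → r ∈ S → (r < x × ¬ below _<_ L r) ⊎ (x < r × below _<_ L r)

  below? : ∀ L r → Dec (below _<_ L r)
  below? -∞ r = yes -∞<fin
  below? ⟨ s ⟩ r = map′ fin<fin (λ { (fin<fin p) → p }) (s O.<? r)
  below? +∞ r = no λ ()

  above? : ∀ r U → Dec (above _<_ r U)
  above? r -∞ = no λ ()
  above? r ⟨ u ⟩ = map′ fin<fin (λ { (fin<fin p) → p }) (r O.<? u)
  above? r +∞ = yes fin<+∞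

  ±-trans : ∀ {a b c} → Lift±< _<_ a ⟨ b ⟩ → Lift±< _<_ ⟨ b ⟩ c → Lift±< _<_ a c
  ±-trans -∞<fin      (fin<fin q) = -∞<fin
  ±-trans -∞<fin      fin<+∞      = -∞<+∞
  ±-trans (fin<fin p) (fin<fin q) = fin<fin (O.trans p q)
  ±-trans (fin<fin p) fin<+∞      = fin<+∞

  ¬below⇒< : ∀ {L x r} → below _<_ L x → ¬ below _<_ L r → r < x
  ¬below⇒< {L} {x} {r} p n with O.compare r x
  ... | tri< q _ _    = q
  ... | tri≈ _ refl _ = ⊥-elim (n p)
  ... | tri> _ _ q    = ⊥-elim (n (±-trans p (fin<fin q)))

  ¬above⇒< : ∀ {U x r} → above _<_ x U → ¬ above _<_ r U → x < r
  ¬above⇒< {U} {x} {r} p n with O.compare x r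
  ... | tri< q _ _    = q
  ... | tri≈ _ refl _ = ⊥-elim (n p)
  ... | tri> _ _ q    = ⊥-elim (n (±-trans (fin<fin q) p))

  -- `U` is the least element of `S` above `L`, or `+∞` if there is none. This converts a cut into
  -- an open interval, the form in which independence can be applied.
  next : ∀ L S → ¬ L ≡ +∞ → Σ (Ext± G) λ U → Lift±< _<_ L U ×
    (∀ x → below _<_ L x → above _<_ x U → Sep x L S)
  next -∞ [] n = +∞ , -∞<+∞ , λ _ _ _ _ ()
  next ⟨ s ⟩ [] n = +∞ , fin<+∞ , λ _ _ _ _ ()
  next +∞ [] n = ⊥-elim (n refl)
  next L (r ∷ S) n with next L S n | below? L r
  ... | U , L<U , sep | no ¬p = U , L<U , λ where
    x L<x x<U _ (here refl) → inj₁ (¬below⇒< L<x ¬p , ¬p)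
    x L<x x<U s (there i)   → sep x L<x x<U s i
  ... | U , L<U , sep | yes p with above? r U
  ...   | yes r<U = ⟨ r ⟩ , p , λ where
    x L<x (fin<fin x<r) _ (here refl) → inj₂ (x<r , p)
    x L<x (fin<fin x<r) s (there i)   → sep x L<x (±-trans (fin<fin x<r) r<U) s i
  ...   | no ¬r<U = U , L<U , λ where
    x L<x x<U _ (here refl) → inj₂ (¬above⇒< x<U ¬r<U , p)
    x L<x x<U s (there i)   → sep x L<x x<U s i

  -- Every point outside `S` realises one of finitely many cuts, each lying just above an element of
  -- `S` or at the very bottom. This is why finitely many positions are enough as test points.
  greatestBelow : ∀ x S → ¬ x ∈ S → Σ (Ext± G) λ L →
    (L ≡ -∞ ⊎ Σ G λ s → s ∈ S × L ≡ ⟨ s ⟩) × below _<_ L x × Sep x L S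
  greatestBelow x [] n = -∞ , inj₁ refl , -∞<fin , λ _ ()
  greatestBelow x (r ∷ S) n with greatestBelow x S (n ∘ there) | O.compare r x
  ... | _ | tri≈ _ refl _ = ⊥-elim (n (here refl))
  ... | L , o , L<x , sep | tri> _ _ x<r =
    L , [ inj₁ , (λ { (s , i , e) → inj₂ (s , there i , e) }) ]′ o , L<x , λ where
      _ (here refl) → inj₂ (x<r , ±-trans L<x (fin<fin x<r))
      s (there i)   → sep s i
  ... | L , o , L<x , sep | tri< r<x _ _ with below? L r
  ...   | no ¬p = L , [ inj₁ , (λ { (s , i , e) → inj₂ (s , there i , e) }) ]′ o , L<x , λ where
      _ (here refl) → inj₁ (r<x , ¬p)
      s (there i)   → sep s i
  ...   | yes p = ⟨ r ⟩ , inj₂ (r , here refl , refl) , fin<fin r<x , λ where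
      _ (here refl) → inj₁ (r<x , λ { (fin<fin q) → O.irrefl refl q })
      s (there i)   → [ (λ { (s<x , ¬L<s) → inj₁ (s<x , λ { (fin<fin r<s) → ¬L<s (±-trans p (fin<fin r<s)) }) })
                      , (λ { (x<s , _) → inj₂ (x<s , fin<fin (O.trans r<x x<s)) }) ]′ (sep s i)

-- Ordered fields and Hamel spaces

module FieldProperties {c} (C : OrderedField c) where
  open OrderedField C
  private
    module O = IsStrictTotalOrder isStrictTotalOrder
    commutativeRing : CommutativeRing c c
    commutativeRing = record { isCommutativeRing = isCommutativeRing }
  open CommutativeRing commutativeRing
    using (ring; *-identityˡ; *-identityʳ; *-comm; distribˡ; zeroʳ; +-identityˡ; -‿inverseʳ)
  open Algebra.Properties.Ring ring using (-‿distribˡ-*; -‿involutive; -0#≈0#)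

  neg-pos : ∀ {x} → x < 0# → 0# < - x
  neg-pos {x} p = subst₂ _<_ (-‿inverseʳ x) (+-identityˡ (- x)) (+-mono-< x 0# (- x) p)

  0<1 : 0# < 1#
  0<1 with O.compare 0# 1#
  ... | tri< p _ _ = p
  ... | tri≈ _ q _ = ⊥-elim (0≢1 q)
  ... | tri> _ _ r = subst (0# <_) square (*-pos _ _ (neg-pos r) (neg-pos r))
    where
    square : - 1# * - 1# ≡ 1#
    square = trans (sym (-‿distribˡ-* 1# (- 1#)))
               (trans (cong -_ (*-identityˡ (- 1#))) (-‿involutive 1#))

  0<2 : 0# < 1# + 1#
  0<2 = O.trans 0<1 (subst (_< 1# + 1#) (+-identityˡ 1#) (+-mono-< 0# 1# 1# 0<1))

  >0⇒≢0 : ∀ {x} → 0# < x → ¬ x ≡ 0#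
  >0⇒≢0 p refl = O.irrefl refl p

  0<difference : ∀ {x y} → x < y → 0# < y + - x
  0<difference {x} {y} p = subst (_< y + - x) (-‿inverseʳ x) (+-mono-< x y (- x) p)

  inverse-≢0 : ∀ {x y} → x * y ≡ 1# → ¬ y ≡ 0#
  inverse-≢0 {x} e refl = 0≢1 (trans (sym (zeroʳ x)) e)

  ½ : Carrier
  ½ = proj₁ (inverse (1# + 1#) (>0⇒≢0 0<2))

  ½+½ : ½ + ½ ≡ 1#
  ½+½ = trans (cong₂ _+_ (sym (*-identityʳ ½)) (sym (*-identityʳ ½)))
          (trans (sym (distribˡ ½ 1# 1#)) (trans (*-comm ½ (1# + 1#)) (proj₂ (inverse (1# + 1#) (>0⇒≢0 0<2)))))

  ½≢0 : ¬ ½ ≡ 0#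
  ½≢0 = inverse-≢0 (proj₂ (inverse (1# + 1#) (>0⇒≢0 0<2)))

  neg-≢0 : ∀ {x} → ¬ x ≡ 0# → ¬ - x ≡ 0#
  neg-≢0 {x} n e = n (trans (sym (-‿involutive x)) (trans (cong -_ e) -0#≈0#))

  -1≢0 : ¬ - 1# ≡ 0#
  -1≢0 = neg-≢0 (>0⇒≢0 0<1)

-- Valuations and distances in a Hamel space

module HamelProperties {c} (C : OrderedField c) {g} (M : HamelSpace C g) where
  open OrderedField C using (_+_; _*_; -_; 0#; 1#; isCommutativeRing)
  private
    commutativeRing : CommutativeRing c c
    commutativeRing = record { isCommutativeRing = isCommutativeRing }
  open CommutativeRing commutativeRing using (+-identityˡ; -‿inverseʳ)
  open FieldProperties C
  open HamelSpace M
  abelianGroup : AbelianGroup g g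
  abelianGroup = record { isAbelianGroup = isAbelianGroup }
  open AbelianGroupSolver abelianGroup using (solve; _:+_; :-_; _:-_; _:=_)
  open AbelianGroup abelianGroup using (identityˡ; inverseʳ; comm)
  open Algebra.Properties.AbelianGroup abelianGroup using (inverseʳ-unique; identityˡ-unique)
  open ExtendedOrder sto₀

  infixl 6 _−_
  _−_ : G → G → G
  x − y = x ⊕ (⊖ y)

  ·-zeroˡ : ∀ x → 0# · x ≡ 0g
  ·-zeroˡ x = identityˡ-unique (0# · x) (0# · x)
    (trans (sym (·-distribʳ 0# 0# x)) (cong (_· x) (+-identityˡ 0#)))

  ·-zeroʳ : ∀ a → a · 0g ≡ 0g
  ·-zeroʳ a = identityˡ-unique (a · 0g) (a · 0g)
    (trans (sym (·-distribˡ a 0g 0g)) (cong (a ·_) (identityˡ 0g)))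

  ·-neg : ∀ a x → (- a) · x ≡ ⊖ (a · x)
  ·-neg a x = inverseʳ-unique (a · x) ((- a) · x)
    (trans (sym (·-distribʳ a (- a) x)) (trans (cong (_· x) (-‿inverseʳ a)) (·-zeroˡ x)))

  -1· : ∀ x → (- 1#) · x ≡ ⊖ x
  -1· x = trans (·-neg 1# x) (cong ⊖_ (·-identity x))

  ·-⊖ : ∀ a x → a · (⊖ x) ≡ ⊖ (a · x)
  ·-⊖ a x = inverseʳ-unique (a · x) (a · (⊖ x))
    (trans (sym (·-distribˡ a x (⊖ x))) (trans (cong (a ·_) (inverseʳ x)) (·-zeroʳ a)))

  ½-double : ∀ x → ½ · x ⊕ ½ · x ≡ x
  ½-double x = trans (sym (·-distribʳ ½ ½ x)) (trans (cong (_· x) ½+½) (·-identity x))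

  inverse-cancel : ∀ {a b} → a * b ≡ 1# → ∀ x → a · (b · x) ≡ x
  inverse-cancel {a} {b} e x = trans (sym (·-assoc a b x)) (trans (cong (_· x) e) (·-identity x))

  v-zero : v 0g ≡ ∞
  v-zero = proj₂ (v-∞ 0g) refl

  v-neg : ∀ x → v (⊖ x) ≡ v x
  v-neg x = trans (cong v (sym (-1· x))) (v-scal (- 1#) x -1≢0)

  v-sub-comm : ∀ x y → v (x − y) ≡ v (y − x)
  v-sub-comm x y = trans (cong v (solve 2 (λ x y → x :- y := :- (y :- x)) refl x y)) (v-neg (y − x))

  -- Idempotence of `v` lets a value stand for itself: it is an element having that very valuation,
  -- hence usable as a step length.
  v-value : ∀ {x γ} → v x ≡ ↑ γ → v γ ≡ ↑ γ
  v-value {x} e = trans (cong (ext v) (sym e)) (trans (v-idem x) e)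

  v-finite : ∀ {x} → ¬ x ≡ 0g → Σ G λ γ → v x ≡ ↑ γ
  v-finite {x} n with v x in e
  ... | ↑ γ = γ , refl
  ... | ∞   = ⊥-elim (n (proj₁ (v-∞ x) e))

  v-sum≥ : ∀ {x y c} → c ≤∞ v x → c ≤∞ v y → c ≤∞ v (x ⊕ y)
  v-sum≥ {x} {y} p q = ≤∞-trans (min∞-glb (v x) (v y) p q) (v-ultra x y)

  v-diff≥ : ∀ {x y c} → c ≤∞ v x → c ≤∞ v y → c ≤∞ v (x − y)
  v-diff≥ {x} {y} {c} p q = v-sum≥ p (subst (c ≤∞_) (sym (v-neg y)) q)

  v-diff> : ∀ {x y c} → c <∞ v x → c <∞ v y → c <∞ v (x − y)
  v-diff> {x} {y} {c} p q with v x <∞? v y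
  ... | yes r = <-≤∞-trans p (v-diff≥ (inj₂ refl) (inj₁ r))
  ... | no ¬r = <-≤∞-trans q (v-diff≥ (≮∞⇒≥∞ ¬r) (inj₂ refl))

  -- If the sum had larger valuation than `x`, then so would `x = (x + d) - d`.
  v-dominant : ∀ {x d} → v x <∞ v d → v (x ⊕ d) ≡ v x
  v-dominant {x} {d} p = ≤∞-antisym (≮∞⇒≥∞ absurd) (v-sum≥ (inj₂ refl) (inj₁ p))
    where
    absurd : ¬ v x <∞ v (x ⊕ d)
    absurd q = <∞-irrefl (subst (v x <∞_) (cong v (solve 2 (λ x d → x :+ d :- d := x) refl x d)) (v-diff> q p))

  v-½ : ∀ x → v (½ · x) ≡ v x
  v-½ x = v-scal ½ x ½≢0

  v-double : ∀ x → v (x ⊕ x) ≡ v x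
  v-double x = trans (cong v (trans (cong₂ _⊕_ (sym (·-identity x)) (sym (·-identity x)))
    (sym (·-distribʳ 1# 1# x)))) (v-scal (1# + 1#) x (>0⇒≢0 0<2))

  module Linear {_<_ : G → G → Set g} (sto : IsStrictTotalOrder _≡_ _<_)
                (mono : ∀ x y z → x < y → (x ⊕ z) < (y ⊕ z)) where
    private
      module O = IsStrictTotalOrder sto

    <⇒0<− : ∀ {x y} → x < y → 0g < (y − x)
    <⇒0<− {x} {y} p = subst (_< (y − x)) (inverseʳ x) (mono x y (⊖ x) p)

    0<−⇒< : ∀ {x y} → 0g < (y − x) → x < y
    0<−⇒< {x} {y} p = subst₂ _<_ (identityˡ x) (solve 2 (λ x y → y :- x :+ x := y) refl x y) (mono 0g (y − x) x p)

    <-by : ∀ {x y p} → 0g < p → p ≡ y − x → x < y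
    <-by p refl = 0<−⇒< p

    0<⊕ : ∀ {x y} → 0g < x → 0g < y → 0g < (x ⊕ y)
    0<⊕ {x} {y} p q = O.trans p (subst₂ _<_ (identityˡ x) (comm y x) (mono 0g y x q))

    0<½ : ∀ {x} → 0g < x → 0g < (½ · x)
    0<½ {x} p with O.compare 0g (½ · x)
    ... | tri< q _ _ = q
    ... | tri≈ _ q _ = ⊥-elim (O.irrefl (trans (sym (identityˡ 0g)) (trans (cong₂ _⊕_ q q) (½-double x))) p)
    ... | tri> _ _ q = ⊥-elim (O.asym p (subst₂ _<_ (½-double x) (identityˡ 0g)
            (O.trans (mono (½ · x) 0g (½ · x) q) (subst (_< (0g ⊕ 0g)) (comm _ _) (mono (½ · x) 0g 0g q)))))

  -- The order is a parameter so that one argument covers both positions of a nearest centre: it is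
  -- applied to `<₁` for a centre below `x` and to the reverse of `<₁` for one above.
  module Sided {_<_ : G → G → Set g} (sto : IsStrictTotalOrder _≡_ _<_)
               (mono : ∀ x y z → x < y → (x ⊕ z) < (y ⊕ z))
               (v-anti : ∀ x y → 0g < x → x < y → v y ≤∞ v x) where
    private
      module O = IsStrictTotalOrder sto
    open Linear sto mono
    open Cuts sto
    module Dual = Cuts (Flip.isStrictTotalOrder sto)

    v-anti≤ : ∀ {x y} → 0g < x → x < y ⊎ x ≡ y → v y ≤∞ v x
    v-anti≤ {x} {y} p (inj₁ q) = v-anti x y p q
    v-anti≤ p (inj₂ refl) = inj₂ refl

    -- Since `b - a = (x - a) + (b - x)`, the first summand dominates unless both have valuation
    -- `γ`. In that critical case cancellation can only increase the valuation, and the upper bound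
    -- on `v (b − a)` forbids it.
    v-near : ∀ {x a b γ} → γ ≤∞ v (b − x) → v (x − a) ≤∞ γ →
             γ <∞ v (b − x) ⊎ v (b − a) ≤∞ γ → v (b − a) ≡ v (x − a)
    v-near {x} {a} {b} {γ} p q r = by-cases q r
      where
      split-b : b − a ≡ (x − a) ⊕ (b − x)
      split-b = solve 3 (λ a b x → b :- a := (x :- a) :+ (b :- x)) refl a b x

      by-cases : v (x − a) ≤∞ γ → γ <∞ v (b − x) ⊎ v (b − a) ≤∞ γ → v (b − a) ≡ v (x − a)
      by-cases (inj₁ q′) _ = trans (cong v split-b) (v-dominant (<-≤∞-trans q′ p))
      by-cases (inj₂ q′) (inj₁ r′) =
        trans (cong v split-b) (v-dominant (subst (_<∞ v (b − x)) (sym q′) r′))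
      by-cases (inj₂ q′) (inj₂ r′) = trans (≤∞-antisym r′ γ≤) (sym q′)
        where
        γ≤ : γ ≤∞ v (b − a)
        γ≤ = subst (γ ≤∞_) (cong v (sym split-b)) (v-sum≥ (inj₂ (sym q′)) p)

    Agrees : G → G → List G → Set g
    Agrees x b S = ∀ s → s ∈ S → (s < x × s < b) ⊎ (x < s × b < s)

    Candidate : List G → G → G → Set g
    Candidate S W b = Σ G λ l → l ∈ S × (b ≡ l ⊕ W ⊎ Σ G λ u → u ∈ S × b ≡ l ⊕ ½ · (u − l))

    -- Replaces x by a candidate b in the same gap of S with the same valuations over A ⊆ S, when v W is
    -- the maximum of the v(x − a) and is attained below x. Let l, u be the ends of the gap: b is
    -- l + W if u − l > 2W, and the midpoint otherwise, where v(u − l) ≥ v(W).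
    module _ {x W : G} {S A : List G} (A⊆S : ∀ a → a ∈ A → a ∈ S) (x∉S : ¬ x ∈ S) (0<W : 0g < W)
             (bounded : ∀ a → a ∈ A → v (x − a) ≤∞ v W) where

      private
        Result : Set g
        Result = Σ G λ b → Candidate S W b × Agrees x b S × (∀ a → a ∈ A → v (b − a) ≡ v (x − a))

        module Above {l} (l∈S : l ∈ S) (l<x : l < x) (sepₗ : Sep x ⟨ l ⟩ S) (far : v W ≤∞ v (x − l)) where

          left : ∀ {s} → s ∈ S → s < x → s < l ⊎ s ≡ l
          left {s} i s<x with O.compare s l
          ... | tri< p _ _ = inj₁ p
          ... | tri≈ _ p _ = inj₂ p
          ... | tri> _ _ p with sepₗ s i
          ...   | inj₁ (_ , n) = ⊥-elim (n (fin<fin p))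
          ...   | inj₂ (q , _) = ⊥-elim (O.asym s<x q)

          left-< : ∀ {s b} → s ∈ S → s < x → l < b → s < b
          left-< i s<x l<b with left i s<x
          ... | inj₁ p    = O.trans p l<b
          ... | inj₂ refl = l<b

          left-− : ∀ {s b} → s ∈ S → s < x → (b − l) < (b − s) ⊎ (b − l) ≡ (b − s)
          left-− {s} {b} i s<x with left i s<x
          ... | inj₁ p    = inj₁ (<-by (<⇒0<− p) (solve 3 (λ b l s → l :- s := (b :- s) :- (b :- l)) refl b l s))
          ... | inj₂ refl = inj₂ refl

          b₁ : G
          b₁ = l ⊕ W

          b₁−l : b₁ − l ≡ W
          b₁−l = solve 2 (λ l W → l :+ W :- l := W) refl l W

          l<b₁ : l < b₁
          l<b₁ = <-by 0<W (sym b₁−l)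

          b₁-near : v W ≤∞ v (b₁ − x)
          b₁-near = subst (v W ≤∞_) (cong v (solve 3 (λ l W x → W :- (x :- l) := l :+ W :- x) refl l W x))
                      (v-diff≥ (inj₂ refl) far)

          -- A centre below `x` is at most `l`, so its distance from `b₁ = l + W` is at least `W`,
          -- and larger distances have no larger valuation.
          b₁-left : ∀ {a} → a ∈ A → a < x → v (b₁ − a) ≤∞ v W
          b₁-left {a} i a<x = v-anti≤ 0<W (subst (λ z → z < (b₁ − a) ⊎ z ≡ b₁ − a) b₁−l (left-− (A⊆S a i) a<x))

          unbounded : (∀ s → s ∈ S → s < x) → Result
          unbounded S<x = b₁ , (l , l∈S , inj₁ refl)
            , (λ s i → inj₁ (S<x s i , left-< i (S<x s i) l<b₁))
            , (λ a i → v-near b₁-near (bounded a i) (inj₂ (b₁-left i (S<x a (A⊆S a i)))))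

          module Below {u} (u∈S : u ∈ S) (x<u : x < u) (sepᵤ : Dual.Sep x ⟨ u ⟩ S) where

            l<u : l < u
            l<u = O.trans l<x x<u

            right : ∀ {s} → s ∈ S → x < s → u < s ⊎ s ≡ u
            right {s} i x<s with O.compare u s
            ... | tri< p _ _ = inj₁ p
            ... | tri≈ _ p _ = inj₂ (sym p)
            ... | tri> _ _ p with sepᵤ s i
            ...   | inj₁ (_ , n) = ⊥-elim (n (fin<fin p))
            ...   | inj₂ (q , _) = ⊥-elim (O.asym x<s q)

            right-< : ∀ {s b} → s ∈ S → x < s → b < u → b < s
            right-< i x<s b<u with right i x<s
            ... | inj₁ p    = O.trans b<u p
            ... | inj₂ refl = b<u

            right-− : ∀ {s b} → s ∈ S → x < s → (u − b) < (s − b) ⊎ (u − b) ≡ (s − b)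
            right-− {s} {b} i x<s with right i x<s
            ... | inj₁ p    = inj₁ (<-by (<⇒0<− p) (solve 3 (λ b u s → s :- u := (s :- b) :- (u :- b)) refl b u s))
            ... | inj₂ refl = inj₂ refl

            side : ∀ {s} → s ∈ S → s < x ⊎ x < s
            side {s} i with O.compare s x
            ... | tri< p _ _    = inj₁ p
            ... | tri≈ _ refl _ = ⊥-elim (x∉S i)
            ... | tri> _ _ p    = inj₂ p

            -- Cancellation need only be excluded at the two ends of the gap: every centre lies at
            -- or beyond an end, hence at least as far from `b`.
            conclude : ∀ {b} → Candidate S W b → l < b → b < u → v W ≤∞ v (b − x) →
              v W <∞ v (b − x) ⊎ (v (b − l) ≤∞ v W × v (u − b) ≤∞ v W) → Result
            conclude {b} cand l<b b<u near far = b , cand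
              , (λ s i → [ (λ p → inj₁ (p , left-< i p l<b)) , (λ p → inj₂ (p , right-< i p b<u)) ]′ (side i))
              , (λ a i → v-near near (bounded a i) (bound i far))
              where
              bound : ∀ {a} → a ∈ A → v W <∞ v (b − x) ⊎ (v (b − l) ≤∞ v W × v (u − b) ≤∞ v W) →
                      v W <∞ v (b − x) ⊎ v (b − a) ≤∞ v W
              bound i (inj₁ p) = inj₁ p
              bound {a} i (inj₂ (p , q)) with side (A⊆S a i)
              ... | inj₁ a<x = inj₂ (≤∞-trans (v-anti≤ (<⇒0<− l<b) (left-− (A⊆S a i) a<x)) p)
              ... | inj₂ x<a = inj₂ (≤∞-trans (subst (_≤∞ v (u − b)) (v-sub-comm a b)
                                      (v-anti≤ (<⇒0<− b<u) (right-− (A⊆S a i) x<a))) q)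

            δ b₂ : G
            δ  = ½ · (u − l)
            b₂ = l ⊕ δ

            0<δ : 0g < δ
            0<δ = 0<½ (<⇒0<− l<u)

            b₂−l : b₂ − l ≡ δ
            b₂−l = solve 2 (λ l δ → l :+ δ :- l := δ) refl l δ

            u−b₂ : u − b₂ ≡ δ
            u−b₂ = trans (solve 3 (λ l u δ → u :- (l :+ δ) := (u :- l) :- δ) refl l u δ)
                     (trans (cong (_− δ) (sym (½-double (u − l)))) (solve 1 (λ δ → δ :+ δ :- δ := δ) refl δ))

            wide : W < (u − b₁) → Result
            wide W<u−b₁ = conclude (l , l∈S , inj₁ refl) l<b₁ (0<−⇒< (O.trans 0<W W<u−b₁)) b₁-near
              (inj₂ (inj₂ (cong v b₁−l) , v-anti W (u − b₁) 0<W W<u−b₁))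

            -- As `v (W ⊕ W) = v W`, the gap has valuation at least `v W`; and since `x` and the
            -- midpoint both lie in it, their difference has at least the valuation of the gap.
            narrow : (u − l) < (W ⊕ W) ⊎ (u − l) ≡ W ⊕ W → Result
            narrow u−l≤2W = conclude (l , l∈S , inj₂ (u , u∈S , refl))
              (<-by 0<δ (sym b₂−l)) (<-by 0<δ (sym u−b₂)) (≤∞-trans γ≤ close) (gap γ≤)
              where
              γ≤ : v W ≤∞ v (u − l)
              γ≤ = subst (_≤∞ v (u − l)) (v-double W) (v-anti≤ (<⇒0<− l<u) u−l≤2W)

              close : v (u − l) ≤∞ v (b₂ − x)
              close = subst (v (u − l) ≤∞_) (cong v (solve 3 (λ l δ x → δ :- (x :- l) := l :+ δ :- x) refl l δ x))
                (v-diff≥ (inj₂ (sym (v-½ (u − l))))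
                  (v-anti (x − l) (u − l) (<⇒0<− l<x)
                    (<-by (<⇒0<− x<u) (solve 3 (λ l u x → u :- x := (u :- l) :- (x :- l)) refl l u x))))

              -- If the gap has valuation above `v W`, then moving inside it cannot affect any
              -- constraint. Otherwise half of the gap still has valuation exactly `v W`, so the
              -- midpoint is not too close to either end.
              gap : v W ≤∞ v (u − l) → v W <∞ v (b₂ − x) ⊎ (v (b₂ − l) ≤∞ v W × v (u − b₂) ≤∞ v W)
              gap (inj₁ p) = inj₁ (<-≤∞-trans p close)
              gap (inj₂ p) = inj₂ ( inj₂ (trans (cong v b₂−l) (trans (v-½ (u − l)) (sym p)))
                                  , inj₂ (trans (cong v u−b₂) (trans (v-½ (u − l)) (sym p))))

            result : Result
            result with O.compare (u − l) (W ⊕ W)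
            ... | tri< p _ _ = narrow (inj₁ p)
            ... | tri≈ _ p _ = narrow (inj₂ p)
            ... | tri> _ _ p = wide (<-by (<⇒0<− p)
                    (solve 3 (λ l u W → (u :- l) :- (W :+ W) := (u :- (l :+ W)) :- W) refl l u W))

          finish : Result
          finish with Dual.greatestBelow x S x∉S
          ... | _ , inj₂ (u , u∈S , refl) , fin<fin x<u , sepᵤ = Below.result u∈S x<u sepᵤ
          ... | _ , inj₁ refl , _ , sepᵤ = unbounded λ s i →
            [ (λ { (_ , n) → ⊥-elim (n -∞<fin) }) , proj₁ ]′ (sepᵤ s i)

      -- The centre attaining the maximum lies in `S` below `x`, so the gap has a lower end `l` with
      -- `a ≤ l < x`. Then `x - l ≤ x - a` gives `v W ≤ v (x − l)`.
      sided : ∀ {a} → a ∈ A → a < x → v (x − a) ≡ v W → Result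
      sided {a} a∈A a<x e with greatestBelow x S x∉S
      ... | _ , inj₁ refl , _ , sep with sep a (A⊆S a a∈A)
      ...   | inj₁ (_ , n) = ⊥-elim (n -∞<fin)
      ...   | inj₂ (p , _) = ⊥-elim (O.asym a<x p)
      sided {a} a∈A a<x e | _ , inj₂ (l , l∈S , refl) , fin<fin l<x , sep =
        Above.finish l∈S l<x sep (subst (_≤∞ v (x − l)) e (v-anti≤ (<⇒0<− l<x) x−l≤x−a))
        where
        x−l≤x−a : (x − l) < (x − a) ⊎ (x − l) ≡ x − a
        x−l≤x−a with O.compare a l
        ... | tri< p _ _    = inj₁ (<-by (<⇒0<− p) (solve 3 (λ a l x → l :- a := (x :- a) :- (x :- l)) refl a l x))
        ... | tri≈ _ refl _ = inj₂ refl
        ... | tri> _ _ p with sep a (A⊆S a a∈A)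
        ...   | inj₁ (_ , n) = ⊥-elim (n (fin<fin p))
        ...   | inj₂ (q , _) = ⊥-elim (O.asym a<x q)

-- Existence of points with prescribed cuts and valuations

module HamelExistence {c} (C : OrderedField c) {g} (M : HamelSpace C g) where
  open FieldProperties C
  open HamelSpace M
  open HamelProperties C M
  open AbelianGroupSolver abelianGroup using (solve; :0; _:+_; :-_; _:-_; _:=_)
  open AbelianGroup abelianGroup using (identityˡ)
  open Algebra.Properties.AbelianGroup abelianGroup using (x∙y⁻¹≈ε⇒x≈y)
  open ExtendedOrder sto₀
  module Cuts₀ = Cuts sto₀
  module Cuts₁ = Cuts sto₁
  private
    module O₀ = IsStrictTotalOrder sto₀
    module O₁ = IsStrictTotalOrder sto₁

  private
    module L₁ = Linear sto₁ ⊕-mono-<₁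
    module L₁ᵒ = Linear (Flip.isStrictTotalOrder sto₁) (λ x y z → ⊕-mono-<₁ y x z)

  -- Negation reverses `<₁` and preserves `v`, so the reversed order has the same monotonicity.
  v-antiᵒ : ∀ x y → x <₁ 0g → y <₁ x → v y ≤∞ v x
  v-antiᵒ x y x<0 y<x = subst₂ _≤∞_ (v-neg y) (v-neg x) (v-mono (⊖ x) (⊖ y)
    (subst (0g <₁_) (identityˡ (⊖ x)) (L₁.<⇒0<− x<0))
    (L₁.<-by (L₁.<⇒0<− y<x) (solve 2 (λ x y → x :- y := :- y :- :- x) refl x y)))

  private
    module R = Sided sto₁ ⊕-mono-<₁ v-mono
    module Rᵒ = Sided (Flip.isStrictTotalOrder sto₁) (λ x y z → ⊕-mono-<₁ y x z) v-antiᵒ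

  value-pos : ∀ {W} → v W ≡ ↑ W → 0g <₁ W
  value-pos {W} e with subst (Lift< _<₁_ (↑ 0g)) e (v-pos W)
  ... | fin<fin p = p

  nearest : ∀ x (A : List G) {a} → a ∈ A → Σ G λ a → a ∈ A × (∀ a′ → a′ ∈ A → v (x − a′) ≤∞ v (x − a))
  nearest x (a ∷ []) _ = a , here refl , λ { _ (here refl) → inj₂ refl }
  nearest x (a ∷ A@(_ ∷ _)) _ with nearest x A (here refl)
  ... | a₁ , i , max with v (x − a) <∞? v (x − a₁)
  ...   | yes p = a₁ , there i , λ where
    _  (here refl) → inj₁ p
    a′ (there j)   → max a′ j
  ...   | no ¬p = a , here refl , λ where
    _  (here refl) → inj₂ refl
    a′ (there j)   → ≤∞-trans (max a′ j) (≮∞⇒≥∞ ¬p)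

  −-≢0 : ∀ {x a} → ¬ x ≡ a → ¬ x − a ≡ 0g
  −-≢0 n e = n (x∙y⁻¹≈ε⇒x≈y _ _ e)

  -- Both signs of `W` occur because the nearest centre may lie on either side of `x`; the form of a
  -- midpoint does not depend on the side.
  Candidate : List G → G → G → Set g
  Candidate S W b = Σ G λ l → l ∈ S ×
    ((b ≡ l ⊕ W ⊎ b ≡ l ⊕ (⊖ W)) ⊎ Σ G λ u → u ∈ S × b ≡ l ⊕ ½ · (u − l))

  -- The step length is the largest of the valuations `v (x − a)`. It is finite since `x` is no
  -- centre, and it is a `<₁`-positive element with itself as valuation. The centre `a` is returned
  -- too, because its constraint supplies a term denoting `W`.
  candidate : ∀ {x} {S A : List G} → (∀ a → a ∈ A → a ∈ S) → ¬ x ∈ S → ∀ {a₀} → a₀ ∈ A →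
    Σ G λ a → Σ G λ W → a ∈ A × v (x − a) ≡ ↑ W × Σ G λ b → Candidate S W b ×
      Cuts₁.Sep x ⟨ b ⟩ S × (∀ a → a ∈ A → v (b − a) ≡ v (x − a))
  candidate {x} {S} {A} A⊆S x∉S i₀ with nearest x A i₀
  ... | a , i , max = a , W , i , vxa , result
    where
    x≢a : ¬ x ≡ a
    x≢a refl = x∉S (A⊆S a i)

    W : G
    W = proj₁ (v-finite (−-≢0 x≢a))

    vxa : v (x − a) ≡ ↑ W
    vxa = proj₂ (v-finite (−-≢0 x≢a))

    vW : v W ≡ ↑ W
    vW = v-value vxa

    bounded : ∀ {γ} → v γ ≡ ↑ W → ∀ a′ → a′ ∈ A → v (x − a′) ≤∞ v γ
    bounded {γ} e a′ j = subst (v (x − a′) ≤∞_) (trans vxa (sym e)) (max a′ j)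

    v-W : v (⊖ W) ≡ ↑ W
    v-W = trans (v-neg W) vW

    sep : ∀ {b} → R.Agrees x b S → Cuts₁.Sep x ⟨ b ⟩ S
    sep agree s j with agree s j
    ... | inj₁ (s<x , s<b) = inj₁ (s<x , λ { (fin<fin b<s) → O₁.asym s<b b<s })
    ... | inj₂ (x<s , b<s) = inj₂ (x<s , fin<fin b<s)

    result : Σ G λ b → Candidate S W b × Cuts₁.Sep x ⟨ b ⟩ S × (∀ a → a ∈ A → v (b − a) ≡ v (x − a))
    result with O₁.compare x a
    ... | tri≈ _ e _ = ⊥-elim (x≢a e)
    ... | tri> _ _ a<x with R.sided A⊆S x∉S (value-pos vW) (bounded vW) i a<x (trans vxa (sym vW))
    ...   | b , (l , l∈S , inj₁ e) , agree , same = b , (l , l∈S , inj₁ (inj₁ e)) , sep agree , same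
    ...   | b , (l , l∈S , inj₂ e) , agree , same = b , (l , l∈S , inj₂ e) , sep agree , same
    -- In the reversed order it is `⊖ W` that is positive; its valuation is the same.
    result | tri< x<a _ _ with Rᵒ.sided A⊆S x∉S
               (L₁.<-by (value-pos vW) (solve 1 (λ W → W := :0 :- :- W) refl W))
               (bounded v-W) i x<a (trans vxa (sym v-W))
    ...   | b , (l , l∈S , inj₁ e) , agree , same =
              b , (l , l∈S , inj₁ (inj₂ e)) , sep (λ s → swap ∘ agree s) , same
    ...   | b , (l , l∈S , inj₂ e) , agree , same =
              b , (l , l∈S , inj₂ e) , sep (λ s → swap ∘ agree s) , same

  -- By monotonicity `v` is constant between an element and its double, since these have equal
  -- valuation. So `x` may move up from `b` until its distance from `a` has doubled, if `a` is
  -- below, or halved, if `a` is above.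
  v-clopen : ∀ {b a} → ¬ b ≡ a → Σ G λ r → b <₁ r × (∀ x → b <₁ x → x <₁ r → v (x − a) ≡ v (b − a))
  v-clopen {b} {a} b≢a with O₁.compare b a
  ... | tri≈ _ e _ = ⊥-elim (b≢a e)
  ... | tri> _ _ a<b = b ⊕ δ , L₁.<-by 0<δ (solve 2 (λ b δ → δ := b :+ δ :- b) refl b δ)
    , λ x b<x x<r → ≤∞-antisym
        (v-mono (b − a) (x − a) 0<δ (L₁.<-by (L₁.<⇒0<− b<x)
          (solve 3 (λ a b x → x :- b := (x :- a) :- (b :- a)) refl a b x)))
        (subst (_≤∞ v (x − a)) (v-double δ) (v-mono (x − a) (δ ⊕ δ)
          (L₁.<⇒0<− (O₁.trans a<b b<x))
          (L₁.<-by (L₁.<⇒0<− x<r) (solve 3 (λ a b x → b :+ (b :- a) :- x := (b :- a) :+ (b :- a) :- (x :- a)) refl a b x))))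
    where
    δ : G
    δ = b − a
    0<δ : 0g <₁ δ
    0<δ = L₁.<⇒0<− a<b
  ... | tri< b<a _ _ = b ⊕ η , L₁.<-by 0<η (solve 2 (λ b η → η := b :+ η :- b) refl b η)
    , λ x b<x x<r → trans (v-sub-comm x a) (trans (≤∞-antisym
        (subst (v (a − x) ≤∞_) (v-½ (a − b)) (v-mono η (a − x) 0<η (L₁.<-by (L₁.<⇒0<− x<r)
          (trans (solve 3 (λ η b x → b :+ η :- x := η :+ η :- x :+ b :- η) refl η b x)
            (trans (cong (λ z → z − x ⊕ b − η) (½-double (a − b)))
              (solve 4 (λ η a b x → a :- b :- x :+ b :- η := a :- x :- η) refl η a b x))))))
        (v-mono (a − x) (a − b) (L₁.<-by (L₁.0<⊕ (L₁.<⇒0<− x<r) 0<η)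
          (trans (solve 3 (λ η b x → b :+ η :- x :+ η := η :+ η :+ (b :- x)) refl η b x)
            (trans (cong (_⊕ (b − x)) (½-double (a − b)))
              (solve 3 (λ a b x → a :- b :+ (b :- x) := a :- x :- :0) refl a b x))))
          (L₁.<-by (L₁.<⇒0<− b<x) (solve 3 (λ a b x → x :- b := a :- b :- (a :- x)) refl a b x))))
        (v-sub-comm a b))
    where
    η : G
    η = ½ · (a − b)
    0<η : 0g <₁ η
    0<η = L₁.0<½ (L₁.<⇒0<− b<a)

  v-stable : ∀ b A → ¬ b ∈ A → Σ (List G) λ rs →
    ∀ x → b <₁ x → Cuts₁.Sep x ⟨ b ⟩ rs → ∀ a → a ∈ A → v (x − a) ≡ v (b − a)
  v-stable b [] n = [] , λ _ _ _ _ ()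
  v-stable b (a ∷ A) n with v-clopen {b} {a} (n ∘ here) | v-stable b A (n ∘ there)
  ... | r , b<r , stable | rs , stables = r ∷ rs , λ where
    x b<x sep _ (here refl) → stable x b<x
      ([ (λ { (_ , b≮r) → ⊥-elim (b≮r (fin<fin b<r)) }) , proj₁ ]′ (sep r (here refl)))
    x b<x sep a′ (there i) → stables x b<x (λ r → sep r ∘ there) a′ i

  -- The valuations hold throughout an interval of `<₁` just above `b`. Adding the ends of these
  -- intervals to `S₁` turns everything asked of `<₁` into one cut, and independence realises it
  -- together with the cut for `<₀`.
  realise : Independent → ∀ L₀ b S₀ S₁ A → ¬ L₀ ≡ +∞ → ¬ b ∈ A → Σ G λ x →
    Cuts₀.Sep x L₀ S₀ × Cuts₁.Sep x ⟨ b ⟩ S₁ × (∀ a → a ∈ A → v (x − a) ≡ v (b − a))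
  realise ind L₀ b S₀ S₁ A L₀≢ b∉A with v-stable b A b∉A
  ... | rs , stable with Cuts₀.next L₀ S₀ L₀≢ | Cuts₁.next ⟨ b ⟩ (S₁ ++ rs) (λ ())
  ...   | U₀ , p₀ , sep₀ | U₁ , p₁ , sep₁ with ind L₀ U₀ ⟨ b ⟩ U₁ p₀ p₁
  ...     | x , (l₀ , u₀) , (fin<fin l₁ , u₁) = x , sep₀ x l₀ u₀
    , (λ r → sep₁ x (fin<fin l₁) u₁ r ∘ ∈-++⁺ˡ)
    , stable x l₁ (λ r → sep₁ x (fin<fin l₁) u₁ r ∘ ∈-++⁺ʳ S₁)

  -- Density finds a value inside any bounded `<₀`-interval, so no cut above a position is without
  -- values.
  realise-value : Independent → Dense → ∀ L S → ¬ L ≡ +∞ → Σ G λ w → v w ≡ ↑ w × Cuts₀.Sep w L S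
  realise-value ind dense L S L≢ with Cuts₀.next L S L≢
  -- Density needs two elements of `G`, whereas `L` and `U` may be infinite; independence first
  -- supplies `y <₀ z` strictly between them.
  ... | U , p , sep with ind L U -∞ +∞ p -∞<+∞
  ...   | y , (L<y , y<U) , _ with ind ⟨ y ⟩ U -∞ +∞ y<U -∞<+∞
  ...     | z , (fin<fin y<z , z<U) , _ with dense y z y<z
  ...       | d , y<vd , vd<z with v d in e
  ...         | ∞ = ⊥-elim (no-∞ vd<z)
    where
    no-∞ : ¬ ∞ <∞ ↑ z
    no-∞ ()
  ...         | ↑ w = w , v-value e , sep w (Cuts₀.±-trans L<y (lift y<vd)) (Cuts₀.±-trans (lift vd<z) z<U)
    where
    lift : ∀ {s t} → ↑ s <∞ ↑ t → below _<₀_ ⟨ s ⟩ t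
    lift (fin<fin q) = fin<fin q

  -- If `s` were at most `w`, its valuation would be at least `v w = w`.
  value-<₁ : ∀ {w s} → v w ≡ ↑ w → 0g <₁ s → v s <∞ ↑ w → w <₁ s
  value-<₁ {w} {s} e 0<s p with O₁.compare w s
  ... | tri< q _ _    = q
  ... | tri≈ _ refl _ = ⊥-elim (<∞-irrefl (subst (_<∞ ↑ w) e p))
  ... | tri> _ _ s<w  = ⊥-elim (<∞-irrefl (≤-<∞-trans (subst (_≤∞ v s) e (v-mono s w 0<s s<w)) p))

  value-<₁⁻¹ : ∀ {w s} → v w ≡ ↑ w → w <₁ s → 0g <₁ s × v s ≤∞ ↑ w
  value-<₁⁻¹ {w} {s} e p = O₁.trans (value-pos e) p , subst (v s ≤∞_) e (v-mono w s (value-pos e) p)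

  v-value-−< : ∀ {w a} → v w ≡ ↑ w → ↑ w <∞ v a → v (w − a) ≡ ↑ w
  v-value-−< {w} {a} e p = trans (v-dominant (subst₂ _<∞_ (sym e) (sym (v-neg a)) p)) e

  v-value-−> : ∀ {w a} → v w ≡ ↑ w → v a <∞ ↑ w → v (w − a) ≡ v a
  v-value-−> {w} {a} e p = trans (v-sub-comm w a) (v-dominant (subst (v a <∞_) (trans (sym e) (sym (v-neg w))) p))

-- The elimination procedure

module Elimination {c} (C : OrderedField c) where
  open OrderedField C using (Carrier; _+_; _*_; -_; 0#; 1#; inverse; isStrictTotalOrder; _<_)
  open FieldProperties C
  module CO = IsStrictTotalOrder isStrictTotalOrder

  infix 8 _≺[_]_
  -- The Boolean selects the order: `false` is `<₀`, `true` is `<₁`. Equality gets no atom, since by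
  -- trichotomy it is the failure of both strict inequalities.
  data Atom (n : ℕ) : Set c where
    _≺[_]_ : Term C n → Bool → Term C n → Atom n

  Q : ℕ → Set c
  Q n = BF (Atom n)

  infixl 6 _⊟_
  _⊟_ : ∀ {n} → Term C n → Term C n → Term C n
  t ⊟ s = t ⊞ λ[ - 1# ] s

  eq : ∀ {n} → Term C n → Term C n → Q n
  eq t s = ~ at (t ≺[ false ] s) & ~ at (s ≺[ false ] t)

  finite : ∀ {n} → Term C n → Q n
  finite t = at (t ≺[ false ] ∞ₜ)

  Sub : ℕ → ℕ → Set c
  Sub m n = Fin m → Term C n

  sub : ∀ {m n} → Sub m n → Term C m → Term C n
  sub σ (var i)    = σ i
  sub σ 𝟘          = 𝟘
  sub σ ∞ₜ         = ∞ₜ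
  sub σ (t ⊞ s)    = sub σ t ⊞ sub σ s
  sub σ (λ[ a ] t) = λ[ a ] (sub σ t)
  sub σ (vₜ t)     = vₜ (sub σ t)

  subAtom : ∀ {m n} → Sub m n → Atom m → Atom n
  subAtom σ (t ≺[ o ] s) = sub σ t ≺[ o ] sub σ s

  subQ : ∀ {m n} → Sub m n → Q m → Q n
  subQ σ φ = φ >>= at ∘ subAtom σ

  weaken : ∀ {n} → Sub n (suc n)
  weaken = var ∘ suc

  inst : ∀ {n} → Term C n → Sub (suc n) n
  inst t zero    = t
  inst t (suc i) = var i

  -- Atomic conditions on one distinguished finite element x, outside the scope of every v;
  -- I indexes the orders that may be used to compare with x.
  data LAtom (I : Set) (n : ℕ) : Set c where
    param : Atom n → LAtom I n
    lt gt : I → Term C n → LAtom I n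

  LF : Set → ℕ → Set c
  LF I n = BF (LAtom I n)

  params : ∀ {I n} → Q n → LF I n
  params φ = φ >>= at ∘ param

  subLAtom : ∀ {I m n} → Sub m n → LAtom I m → LAtom I n
  subLAtom σ (param α) = param (subAtom σ α)
  subLAtom σ (lt i e)  = lt i (sub σ e)
  subLAtom σ (gt i e)  = gt i (sub σ e)

  subLF : ∀ {I m n} → Sub m n → LF I m → LF I n
  subLF σ φ = φ >>= at ∘ subLAtom σ

  -- (c , s) stands for c x + s.
  Lin : ℕ → Set c
  Lin n = Carrier × Term C n

  subLin : ∀ {m n} → Sub m n → Lin m → Lin n
  subLin σ (a , s) = a , sub σ s

  -- The point `x` at which `a x + t` and `b x + s` cross.
  quotient : ∀ {n} a b → b < a → Term C n → Term C n → Term C n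
  quotient a b b<a s t = λ[ proj₁ (inverse (a + - b) (>0⇒≢0 (0<difference b<a))) ] (s ⊟ t)

  linear-< : ∀ {n} → Bool → Lin n → Lin n → LF Bool n
  linear-< o (a , s) (b , t) with CO.compare a b
  ... | tri< a<b _ _ = at (gt o (quotient b a a<b s t))
  ... | tri≈ _ _ _   = params (at (s ≺[ o ] t))
  ... | tri> _ _ b<a = at (lt o (quotient a b b<a t s))

  less : ∀ {n} → Bool → Lin n → Lin n → LF Bool n
  less o (a , s) (b , t) =
    ite (params (finite s)) (ite (params (finite t)) (linear-< o (a , s) (b , t)) true) (~ true)

  -- For c ≠ 0, v(c x + s) is v(x - a) with a = - c⁻¹ s. What becomes of v(x - a) is left to
  -- `handle`; the continuation-passing style lets it branch or extend the context.
  module Flatten (R : ℕ → Set c) where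

    Cps : (ℕ → Set c) → ℕ → Set c
    Cps B m = (∀ {m′} → Sub m m′ → B m′ → R m′) → R m

    module _ (handle : ∀ {m} → Term C m → Cps Lin m) where

      valuation : ∀ {m} → Lin m → Cps Lin m
      valuation (a , s) k with a CO.≟ 0#
      ... | yes _  = k var (0# , vₜ s)
      ... | no a≢0 = handle (λ[ - proj₁ (inverse a a≢0) ] s) k

      linearise : ∀ {n m} → Term C (suc n) → Sub n m → Cps Lin m
      linearise (var zero)    σ k = k var (1# , 𝟘)
      linearise (var (suc i)) σ k = k var (0# , σ i)
      linearise 𝟘  σ k = k var (0# , 𝟘)
      linearise ∞ₜ σ k = k var (0# , ∞ₜ)
      linearise (t ⊞ s) σ k =
        linearise t σ λ ω₁ l₁ → linearise s (sub ω₁ ∘ σ) λ ω₂ l₂ →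
        k (sub ω₂ ∘ ω₁) (proj₁ l₁ + proj₁ l₂ , sub ω₂ (proj₂ l₁) ⊞ proj₂ l₂)
      linearise (λ[ a ] t) σ k =
        linearise t σ λ ω l → k ω (a * proj₁ l , λ[ a ] (proj₂ l))
      linearise (vₜ t) σ k =
        linearise t σ λ ω₁ l₁ → valuation l₁ λ ω₂ l₂ → k (sub ω₂ ∘ ω₁) l₂

      flatten : ∀ {n m} → Q (suc n) → Sub n m → Cps (LF Bool) m
      flatten (at (t ≺[ o ] s)) σ k =
        linearise t σ λ ω₁ l₁ → linearise s (sub ω₁ ∘ σ) λ ω₂ l₂ →
        k (sub ω₂ ∘ ω₁) (less o (subLin ω₂ l₁) l₂)
      flatten true    σ k = k var true
      flatten (φ & ψ) σ k =
        flatten φ σ λ ω₁ χ₁ → flatten ψ (sub ω₁ ∘ σ) λ ω₂ χ₂ →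
        k (sub ω₂ ∘ ω₁) (subLF ω₂ χ₁ & χ₂)
      flatten (~ φ) σ k = flatten φ σ λ ω χ → k ω (~ χ)

  -- `after t` is infinitesimally above t, `bottom` below every term.
  data Position (n : ℕ) : Set c where
    bottom : Position n
    after  : Term C n → Position n

  proper : ∀ {n} → Position n → Q n
  proper bottom    = true
  proper (after t) = finite t

  position-< : ∀ {n} → Position n → Bool → Term C n → Q n
  position-< bottom    o e = true
  position-< (after t) o e = at (t ≺[ o ] e)

  module _ {I : Set} (order : I → Bool) {n : ℕ} where

    atTerm : Term C n → LAtom I n → Q n
    atTerm t (param α) = at α
    atTerm t (lt i e)  = at (t ≺[ order i ] e)
    atTerm t (gt i e)  = at (e ≺[ order i ] t)

    -- A point infinitesimally above a position equals none of the bounds, so `gt` can be read as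
    -- the negation of `lt`.
    atPosition : (I → Position n) → LAtom I n → Q n
    atPosition π (param α) = at α
    atPosition π (lt i e)  = position-< (π i) (order i) e
    atPosition π (gt i e)  = ~ position-< (π i) (order i) e

  bounds : ∀ {I n} → LAtom I n → List (Term C n)
  bounds (param _) = []
  bounds (lt _ e)  = e ∷ []
  bounds (gt _ e)  = e ∷ []

  terms : ∀ {I n} → LF I n → List (Term C n)
  terms φ = concatMap bounds (atoms φ)

  anyPosition : ∀ {n} → List (Term C n) → (Position n → Q n) → Q n
  anyPosition S k = k bottom or any S (k ∘ after)

  is : ∀ {I n} → I → Term C n → LF I n
  is i e = ~ at (lt i e) & ~ at (gt i e)

  -- for a value x, v(x - a) is x or v(a), except when v(a) = x
  valueHandler : ∀ {m} → Term C m → Flatten.Cps (LF Bool) Lin m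
  valueHandler a k =
    ite (params (finite a))
      (ite (is false (vₜ a)) (k var (0# , vₜ (vₜ a ⊟ a)))
        (ite (at (lt false (vₜ a))) (k var (1# , 𝟘)) (k var (0# , vₜ a))))
      (k var (0# , ∞ₜ))

  -- a value x lies <₁-below e > 0 exactly if v(e) <₀ x, up to the case v(e) = x
  value-<₁ᶠ : ∀ {n} → Term C n → LF ⊤ n
  value-<₁ᶠ e = ite (params (finite e))
    (params (at (𝟘 ≺[ true ] e)) & (at (gt _ (vₜ e)) or (is _ (vₜ e) & params (at (vₜ e ≺[ true ] e)))))
    true

  -- Removes `<₁` from the conditions on a value. For `gt`, the equality to be excluded does not
  -- depend on the order and is expressed through `<₀`.
  toOrder₀ : ∀ {n} → LAtom Bool n → LF ⊤ n
  toOrder₀ (param α)    = at (param α)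
  toOrder₀ (lt false e) = at (lt _ e)
  toOrder₀ (gt false e) = at (gt _ e)
  toOrder₀ (lt true e)  = value-<₁ᶠ e
  toOrder₀ (gt true e)  = ~ value-<₁ᶠ e & ~ is _ e

  valueForm : ∀ {n} → Q (suc n) → LF ⊤ n
  valueForm ψ = Flatten.flatten (LF Bool) valueHandler ψ var (λ _ χ → χ) >>= toOrder₀

  order₀ : ⊤ → Bool
  order₀ _ = false

  module _ {n} (φ : LF ⊤ n) where

    exactValue : Term C n → Q n
    exactValue s = finite s & eq (vₜ s) s & (φ >>= atTerm order₀ s)

    -- The condition of being a value leaves no trace here: by density every such cut contains
    -- values.
    genericValue : Position n → Q n
    genericValue π = proper π & (φ >>= atPosition order₀ (λ _ → π))

    testValue : Q n
    testValue = any (terms φ) exactValue or anyPosition (terms φ) genericValue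

  -- The quantifier ranges over the fixed points of `v`, which are `∞` and the finite values.
  elimValue : ∀ {n} → Q (suc n) → Q n
  elimValue ψ = subQ (inst ∞ₜ) ψ or testValue (valueForm ψ)

  -- Eliminating a point subject to valuation constraints

  Constraints : ℕ → Set c
  Constraints n = List (Term C n × Term C n)

  -- (a , w) stands for v(x - a) = w
  satisfies : ∀ {n} → Constraints n → Term C n → Q n
  satisfies cs x = all cs λ (a , w) → eq (vₜ (x ⊟ a)) w

  -- Just above `b` the distance from a centre `a` keeps its valuation only if `b` differs from `a`;
  -- infinite centres impose nothing.
  avoids : ∀ {n} → Constraints n → Term C n → Q n
  avoids cs x = all cs λ (a , w) → ~ finite a or ~ eq x a

  -- Which constraint carries the maximal `w` varies with the model and the parameters, so the steps
  -- `± w` of all constraints are tried.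
  anyCandidate : ∀ {n} → List (Term C n) → Constraints n → (Term C n → Q n) → Q n
  anyCandidate S cs k = any S λ l →
    any cs (λ (a , w) → k (l ⊞ w) or k (l ⊟ w)) or any S (λ u → k (l ⊞ λ[ ½ ] (u ⊟ l)))

  module _ {n} (cs : Constraints n) (φ : LF Bool n) where

    points : List (Term C n)
    points = map proj₁ cs ++ terms φ

    exact : Term C n → Q n
    exact s = finite s & satisfies cs s & (φ >>= atTerm id s)

    -- Independence permits unrelated cuts for the two orders: above `b` for `<₁`, and at `π` for
    -- `<₀`.
    positions : Term C n → Position n → Bool → Position n
    positions b π o = if o then after b else π

    -- All that realising the two cuts presupposes about `b` is asserted by the formula, so a
    -- useless candidate fails without harm.
    generic : Position n → Term C n → Q n
    generic π b = proper π & finite b & satisfies cs b & avoids cs b &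
      (φ >>= atPosition id (positions b π))

    someCandidate : Position n → Q n
    someCandidate π = anyCandidate points cs (generic π)

    elimLinear : Q n
    elimLinear = any points exact or anyPosition points someCandidate

  -- `bind a X`: X, with the new variable 0 denoting v(x - a)
  data Flat (n : ℕ) : Set c where
    leaf : LF Bool n → Flat n
    bind : Term C n → Flat (suc n) → Flat n

  nameHandler : ∀ {m} → Term C m → Flatten.Cps Flat Lin m
  nameHandler a k = bind a (k weaken (0# , var zero))

  weakenAll : ∀ {n} → Constraints n → Constraints (suc n)
  weakenAll = map λ (a , w) → sub weaken a , sub weaken w

  -- ∃ x. v(x) = w ∧ ⋀ cs ∧ X. The constraint on v(x) provides a nonzero element w to move test points by.
  elim : ∀ {n} → Flat n → Term C n → Constraints n → Q n
  elim (leaf φ)   w cs = elimLinear ((𝟘 , w) ∷ cs) φ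
  elim (bind a X) w cs =
    elimValue (elim X (sub weaken w) ((sub weaken a , var zero) ∷ weakenAll cs))

  -- Variable 0 of the result is reserved for `v(x)`; the parameters of `ψ` are shifted past it.
  flat : ∀ {n} → Q (suc n) → Flat (suc n)
  flat ψ = Flatten.flatten Flat nameHandler ψ weaken (λ _ → leaf)

  exists : ∀ {n} → Q (suc n) → Q n
  exists ψ = subQ (inst ∞ₜ) ψ or elimValue (elim (flat ψ) (var zero) [])

  toQ : ∀ {n} → Formula C n → Q n
  toQ ⊤ᶠ = true
  toQ ⊥ᶠ = ~ true
  toQ (t ≐ s)  = eq t s
  toQ (t ≺₀ s) = at (t ≺[ false ] s)
  toQ (t ≺₁ s) = at (t ≺[ true ] s)
  toQ (¬ᶠ φ)   = ~ toQ φ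
  toQ (φ ∧ᶠ ψ) = toQ φ & toQ ψ
  toQ (φ ∨ᶠ ψ) = toQ φ or toQ ψ
  toQ (φ ⇒ᶠ ψ) = ~ toQ φ or toQ ψ
  toQ (∃ᶠ φ)   = exists (toQ φ)
  toQ (∀ᶠ φ)   = ~ exists (~ toQ φ)

  fromQ : ∀ {n} → Q n → Formula C n
  fromQ (at (t ≺[ false ] s)) = t ≺₀ s
  fromQ (at (t ≺[ true ] s))  = t ≺₁ s
  fromQ true    = ⊤ᶠ
  fromQ (φ & ψ) = fromQ φ ∧ᶠ fromQ ψ
  fromQ (~ φ)   = ¬ᶠ fromQ φ

  fromQ-quantifierFree : ∀ {n} (φ : Q n) → QuantifierFree C (fromQ φ)
  fromQ-quantifierFree (at (t ≺[ false ] s)) = t ≺₀ s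
  fromQ-quantifierFree (at (t ≺[ true ] s))  = t ≺₁ s
  fromQ-quantifierFree true    = ⊤ᶠ
  fromQ-quantifierFree (φ & ψ) = fromQ-quantifierFree φ ∧ᶠ fromQ-quantifierFree ψ
  fromQ-quantifierFree (~ φ)   = ¬ᶠ fromQ-quantifierFree φ

  -- A closed term can only denote `0` or `∞`: group operations do not leave `0`, while `v` sends
  -- both `0` and `∞` to `∞`.
  closedFinite : Term C 0 → Bool
  closedFinite 𝟘          = true
  closedFinite ∞ₜ         = false
  closedFinite (t ⊞ s)    = closedFinite t ∧ closedFinite s
  closedFinite (λ[ a ] t) = closedFinite t
  closedFinite (vₜ t)     = false

  closedAtom : Atom 0 → Bool
  closedAtom (t ≺[ o ] s) = closedFinite t ∧ not (closedFinite s)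

-- Correctness of the procedure

module Correctness {c} (C : OrderedField c) {g} (M : HamelSpace C g) where
  open OrderedField C using (Carrier; _+_; _*_; -_; 0#; 1#; inverse; _<_)
  open FieldProperties C
  open HamelSpace M
  open HamelProperties C M
  open HamelExistence C M
  open AbelianGroupSolver abelianGroup using (solve; _:+_; _:-_; _:=_)
  open AbelianGroup abelianGroup using (identityˡ; identityʳ; inverseʳ)
  open Algebra.Properties.AbelianGroup abelianGroup using (⁻¹-involutive; x∙y⁻¹≈ε⇒x≈y)
  open ExtendedOrder sto₀
  open Elimination C
  open Semantics C M using (cons; evalₜ; Sat)

  Env : ℕ → Set g
  Env n = Fin n → Ext∞ G

  R : Bool → G → G → Set g
  R false = _<₀_
  R true  = _<₁_

  sto : ∀ o → IsStrictTotalOrder _≡_ (R o)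
  sto false = sto₀
  sto true  = sto₁

  R-mono : ∀ o x y z → R o x y → R o (x ⊕ z) (y ⊕ z)
  R-mono false = ⊕-mono-<₀
  R-mono true  = ⊕-mono-<₁

  R-·-pos : ∀ o a x → 0# < a → R o 0g x → R o 0g (a · x)
  R-·-pos false = ·-pos₀
  R-·-pos true  = ·-pos₁

  infix 4 _<?[_]_
  _<?[_]_ : Ext∞ G → Bool → Ext∞ G → Bool
  p <?[ o ] q = isYes (ExtendedOrder._<∞?_ (sto o) p q)

  evAtom : ∀ {n} → Env n → Atom n → Bool
  evAtom ρ (t ≺[ o ] s) = evalₜ ρ t <?[ o ] evalₜ ρ s

  evQ : ∀ {n} → Env n → Q n → Bool
  evQ ρ = eval (evAtom ρ)

  atom-elim : ∀ {o p q} → T (p <?[ o ] q) → Lift< (R o) p q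
  atom-elim {o} {p} {q} = toWitness {a? = ExtendedOrder._<∞?_ (sto o) p q}

  atom-↑ : ∀ o {x y} → T (↑ x <?[ o ] ↑ y) → R o x y
  atom-↑ o p with atom-elim {o} p
  ... | fin<fin q = q

  atom-intro : ∀ {o p q} → Lift< (R o) p q → T (p <?[ o ] q)
  atom-intro {o} {p} {q} = fromWitness {a? = ExtendedOrder._<∞?_ (sto o) p q}

  finite-intro : ∀ {n} (ρ : Env n) t {x} → evalₜ ρ t ≡ ↑ x → T (evQ ρ (finite t))
  finite-intro ρ t e = atom-intro {false} (subst (_<∞ ∞) (sym e) fin<∞)

  finite-elim : ∀ {n} (ρ : Env n) t → T (evQ ρ (finite t)) → Σ G λ x → evalₜ ρ t ≡ ↑ x
  finite-elim ρ t p with evalₜ ρ t | atom-elim {false} {evalₜ ρ t} {∞} p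
  ... | ↑ x | _ = x , refl

  ¬finite : ∀ {n} (ρ : Env n) t → evalₜ ρ t ≡ ∞ → ¬ T (evQ ρ (finite t))
  ¬finite ρ t e p with trans (sym e) (proj₂ (finite-elim ρ t p))
  ... | ()

  eq-elim : ∀ {n} (ρ : Env n) t s → T (evQ ρ (eq t s)) → evalₜ ρ t ≡ evalₜ ρ s
  eq-elim ρ t s p with &-elim (evAtom ρ) (~ at (t ≺[ false ] s)) (~ at (s ≺[ false ] t)) p | compare∞ (evalₜ ρ t) (evalₜ ρ s)
  ... | n , _ | tri< q _ _ = ⊥-elim (~-elim (evAtom ρ) (at (t ≺[ false ] s)) n (atom-intro {false} q))
  ... | _     | tri≈ _ q _ = q
  ... | _ , n | tri> _ _ q = ⊥-elim (~-elim (evAtom ρ) (at (s ≺[ false ] t)) n (atom-intro {false} q))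

  eq-intro : ∀ {n} (ρ : Env n) t s → evalₜ ρ t ≡ evalₜ ρ s → T (evQ ρ (eq t s))
  eq-intro ρ t s e = &-intro (evAtom ρ) (~ at (t ≺[ false ] s)) (~ at (s ≺[ false ] t))
    (~-intro (evAtom ρ) (at (t ≺[ false ] s)) λ p → <∞-irrefl (subst (_<∞ evalₜ ρ s) e (atom-elim {false} p)))
    (~-intro (evAtom ρ) (at (s ≺[ false ] t)) λ p → <∞-irrefl (subst (evalₜ ρ s <∞_) e (atom-elim {false} p)))

  eval-sub : ∀ {m n} {ρ : Env n} {ρ′ : Env m} {σ : Sub m n} →
    (∀ i → evalₜ ρ (σ i) ≡ ρ′ i) → ∀ t → evalₜ ρ (sub σ t) ≡ evalₜ ρ′ t
  eval-sub e (var i)    = e i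
  eval-sub e 𝟘          = refl
  eval-sub e ∞ₜ         = refl
  eval-sub e (t ⊞ s)    = cong₂ _⊕∞_ (eval-sub e t) (eval-sub e s)
  eval-sub e (λ[ a ] t) = cong (scal∞ a) (eval-sub e t)
  eval-sub e (vₜ t)     = cong (ext v) (eval-sub e t)

  evAtom-sub : ∀ {m n} {ρ : Env n} {ρ′ : Env m} {σ : Sub m n} →
    (∀ i → evalₜ ρ (σ i) ≡ ρ′ i) → ∀ α → evAtom ρ (subAtom σ α) ≡ evAtom ρ′ α
  evAtom-sub e (t ≺[ o ] s) = cong₂ (_<?[ o ]_) (eval-sub e t) (eval-sub e s)

  evQ-sub : ∀ {m n} {ρ : Env n} {ρ′ : Env m} {σ : Sub m n} →
    (∀ i → evalₜ ρ (σ i) ≡ ρ′ i) → ∀ φ → evQ ρ (subQ σ φ) ≡ evQ ρ′ φ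
  evQ-sub {ρ = ρ} {σ = σ} e φ =
    trans (eval->>= (evAtom ρ) φ (at ∘ subAtom σ)) (eval-cong φ λ α _ → evAtom-sub e α)

  evQ-inst : ∀ {n} (ρ : Env n) t φ → evQ ρ (subQ (inst t) φ) ≡ evQ (cons (evalₜ ρ t) ρ) φ
  evQ-inst ρ t = evQ-sub λ { zero → refl ; (suc i) → refl }

  dist : G → Ext∞ G → Ext∞ G
  dist x p = ext v ((↑ x) ⊕∞ scal∞ (- 1#) p)

  dist-↑ : ∀ x a → dist x (↑ a) ≡ v (x − a)
  dist-↑ x a = cong (λ z → v (x ⊕ z)) (-1· a)

  module _ {I : Set} (order : I → Bool) where

    evLAtom : ∀ {n} → G → Env n → LAtom I n → Bool
    evLAtom x ρ (param α) = evAtom ρ α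
    evLAtom x ρ (lt i e)  = ↑ x <?[ order i ] evalₜ ρ e
    evLAtom x ρ (gt i e)  = evalₜ ρ e <?[ order i ] ↑ x

    evLF : ∀ {n} → G → Env n → LF I n → Bool
    evLF x ρ = eval (evLAtom x ρ)

    evLF-params : ∀ {n} x (ρ : Env n) φ → evLF x ρ (params φ) ≡ evQ ρ φ
    evLF-params x ρ φ = eval->>= (evLAtom x ρ) φ (at ∘ param)

    evLAtom-sub : ∀ {m n} {ρ : Env n} {ρ′ : Env m} {σ : Sub m n} x →
      (∀ i → evalₜ ρ (σ i) ≡ ρ′ i) → ∀ α → evLAtom x ρ (subLAtom σ α) ≡ evLAtom x ρ′ α
    evLAtom-sub x h (param α) = evAtom-sub h α
    evLAtom-sub x h (lt i e)  = cong (↑ x <?[ order i ]_) (eval-sub h e)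
    evLAtom-sub x h (gt i e)  = cong (_<?[ order i ] ↑ x) (eval-sub h e)

    evLF-sub : ∀ {m n} {ρ : Env n} {ρ′ : Env m} {σ : Sub m n} x →
      (∀ i → evalₜ ρ (σ i) ≡ ρ′ i) → ∀ φ → evLF x ρ (subLF σ φ) ≡ evLF x ρ′ φ
    evLF-sub {ρ = ρ} {σ = σ} x h φ =
      trans (eval->>= (evLAtom x ρ) φ (at ∘ subLAtom σ)) (eval-cong φ λ α _ → evLAtom-sub x h α)

    atTerm-correct : ∀ {n} (ρ : Env n) t {x} → evalₜ ρ t ≡ ↑ x → ∀ φ →
      evQ ρ (φ >>= atTerm order t) ≡ evLF x ρ φ
    atTerm-correct ρ t {x} h φ = trans (eval->>= (evAtom ρ) φ (atTerm order t)) (eval-cong φ λ α _ → agree α)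
      where
      agree : ∀ α → evQ ρ (atTerm order t α) ≡ evLAtom x ρ α
      agree (param α) = refl
      agree (lt i e)  = cong (_<?[ order i ] evalₜ ρ e) h
      agree (gt i e)  = cong (evalₜ ρ e <?[ order i ]_) h

  evLin : ∀ {n} → G → Env n → Lin n → Ext∞ G
  evLin x ρ (a , s) = (↑ (a · x)) ⊕∞ evalₜ ρ s

  0⊕∞ : ∀ x p → (↑ (0# · x)) ⊕∞ p ≡ p
  0⊕∞ x (↑ y) = cong ↑_ (trans (cong (_⊕ y) (·-zeroˡ x)) (identityˡ y))
  0⊕∞ x ∞     = refl

  module _ (o : Bool) where
    private
      module O = IsStrictTotalOrder (sto o)
    open Linear (sto o) (R-mono o)

    ·-mono : ∀ {a} → 0# < a → ∀ {y z} → R o y z → R o (a · y) (a · z)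
    ·-mono {a} 0<a {y} {z} p = <-by (R-·-pos o a (z − y) 0<a (<⇒0<− p))
      (trans (·-distribˡ a z (⊖ y)) (cong (a · z ⊕_) (·-⊖ a y)))

    ·-cancel : ∀ {a} → 0# < a → ∀ {y z} → R o (a · y) (a · z) → R o y z
    ·-cancel {a} 0<a {y} {z} p with O.compare y z
    ... | tri< q _ _    = q
    ... | tri≈ _ refl _ = ⊥-elim (O.irrefl refl p)
    ... | tri> _ _ q    = ⊥-elim (O.asym p (·-mono 0<a q))

    <-shift : ∀ {x y z w} → R o x y → y − x ≡ w − z → R o z w
    <-shift p e = <-by (<⇒0<− p) e

  difference-· : ∀ a b x → (a + - b) · x ≡ a · x − b · x
  difference-· a b x = trans (·-distribʳ a (- b) x) (cong (a · x ⊕_) (·-neg b x))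

  quotient-eval : ∀ {n} (ρ : Env n) a b (b<a : b < a) s t {y z} → evalₜ ρ s ≡ ↑ y → evalₜ ρ t ≡ ↑ z →
    Σ G λ q → evalₜ ρ (quotient a b b<a s t) ≡ ↑ q × (a + - b) · q ≡ y − z
  quotient-eval ρ a b b<a s t {y} {z} es et rewrite es | et =
    _ , refl , trans (inverse-cancel (proj₂ (inverse (a + - b) (>0⇒≢0 (0<difference b<a)))) (y ⊕ (- 1#) · z)) (cong (y ⊕_) (-1· z))

  -- Multiplying the comparison of `x` with the crossing point by the positive difference of the
  -- coefficients yields an inequality whose sides differ by the same amount as those of the
  -- original one.
  linear-<-correct : ∀ {n} o x (ρ : Env n) a s b t {y z} → evalₜ ρ s ≡ ↑ y → evalₜ ρ t ≡ ↑ z →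
    evLF id x ρ (linear-< o (a , s) (b , t)) ≡ (↑ (a · x ⊕ y) <?[ o ] ↑ (b · x ⊕ z))
  linear-<-correct o x ρ a s b t {y} {z} es et with CO.compare a b
  ... | tri< a<b _ _ with quotient-eval ρ b a a<b s t es et
  ...   | q , eq , e rewrite eq = T-bool
    (λ p → atom-intro {o} (fin<fin (<-shift o (·-mono o (0<difference a<b) (atom-↑ o p)) shift)))
    (λ p → atom-intro {o} (fin<fin (·-cancel o (0<difference a<b) (<-shift o (atom-↑ o p) (sym shift)))))
    where
    shift : (b + - a) · x − (b + - a) · q ≡ (b · x ⊕ z) − (a · x ⊕ y)
    shift = trans (cong₂ _−_ (difference-· b a x) e)
      (solve 4 (λ ax bx y z → bx :- ax :- (y :- z) := bx :+ z :- (ax :+ y)) refl (a · x) (b · x) y z)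
  linear-<-correct o x ρ a s b t {y} {z} es et | tri≈ _ refl _ rewrite es | et = T-bool
    (λ p → atom-intro {o} (fin<fin (<-shift o (atom-↑ o p) e)))
    (λ p → atom-intro {o} (fin<fin (<-shift o (atom-↑ o p) (sym e))))
    where
    e : z − y ≡ (a · x ⊕ z) − (a · x ⊕ y)
    e = solve 3 (λ ax y z → z :- y := ax :+ z :- (ax :+ y)) refl (a · x) y z
  linear-<-correct o x ρ a s b t {y} {z} es et | tri> _ _ b<a with quotient-eval ρ a b b<a t s et es
  ...   | q , eq , e rewrite eq = T-bool
    (λ p → atom-intro {o} (fin<fin (<-shift o (·-mono o (0<difference b<a) (atom-↑ o p)) shift)))
    (λ p → atom-intro {o} (fin<fin (·-cancel o (0<difference b<a) (<-shift o (atom-↑ o p) (sym shift)))))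
    where
    shift : (a + - b) · q − (a + - b) · x ≡ (b · x ⊕ z) − (a · x ⊕ y)
    shift = trans (cong₂ _−_ e (difference-· a b x))
      (solve 4 (λ ax bx y z → z :- y :- (ax :- bx) := bx :+ z :- (ax :+ y)) refl (a · x) (b · x) y z)

  less-correct : ∀ {n} o x (ρ : Env n) l l′ →
    evLF id x ρ (less o l l′) ≡ (evLin x ρ l <?[ o ] evLin x ρ l′)
  less-correct o x ρ (a , s) (b , t) = cases (evalₜ ρ s) (evalₜ ρ t) refl refl
    where
    f : LAtom Bool _ → Bool
    f = evLAtom id x ρ

    fin-s fin-t linear inner : LF Bool _
    fin-s  = params (finite s)
    fin-t  = params (finite t)
    linear = linear-< o (a , s) (b , t)
    inner  = ite fin-t linear true

    is-finite : ∀ r {y} → evalₜ ρ r ≡ ↑ y → T (eval f (params (finite r)))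
    is-finite r e = T-≡ (sym (evLF-params id x ρ (finite r))) (finite-intro ρ r e)

    is-infinite : ∀ r → evalₜ ρ r ≡ ∞ → ¬ T (eval f (params (finite r)))
    is-infinite r e p = ¬finite ρ r e (T-≡ (evLF-params id x ρ (finite r)) p)

    ∞-least : ∀ q → (∞ <?[ o ] q) ≡ false
    ∞-least q with ExtendedOrder._<∞?_ (sto o) ∞ q
    ... | no _ = refl

    cases : ∀ p q → evalₜ ρ s ≡ p → evalₜ ρ t ≡ q →
      eval f (ite fin-s inner (~ true)) ≡ (evLin x ρ (a , s) <?[ o ] evLin x ρ (b , t))
    cases ∞ q es et = trans (ite-false f fin-s inner (~ true) (is-infinite s es))
      (sym (trans (cong (λ p → ((↑ (a · x)) ⊕∞ p) <?[ o ] evLin x ρ (b , t)) es) (∞-least _)))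
    cases (↑ y) ∞ es et = trans (ite-true f fin-s inner (~ true) (is-finite s es))
      (trans (ite-false f fin-t linear true (is-infinite t et))
        (sym (cong₂ (λ p q → ((↑ (a · x)) ⊕∞ p) <?[ o ] ((↑ (b · x)) ⊕∞ q)) es et)))
    cases (↑ y) (↑ z) es et = trans (ite-true f fin-s inner (~ true) (is-finite s es))
      (trans (ite-true f fin-t linear true (is-finite t et))
        (trans (linear-<-correct o x ρ a s b t es et)
          (sym (cong₂ (λ p q → ((↑ (a · x)) ⊕∞ p) <?[ o ] ((↑ (b · x)) ⊕∞ q)) es et))))

  -- Correctness of linearisation

  module FlattenCorrect (R : ℕ → Set c) (x : G) (evR : ∀ {m} → Env m → R m → Bool) where
    open Flatten R

    -- At a fixed environment a computation that branches and adds variables acts like a single call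
    -- of its continuation: in one extended environment, with one result, and uniformly in the
    -- continuation.
    record Yields {p} {B : ℕ → Set c} {m} (ρ : Env m) (κ : Cps B m)
                  (P : ∀ {m′} → Env m′ → B m′ → Set p) : Set (c ⊔ g ⊔ p) where
      constructor yields
      field
        {m′}    : ℕ
        ω       : Sub m m′
        ρ′      : Env m′
        result  : B m′
        extends : ∀ i → evalₜ ρ′ (ω i) ≡ ρ i
        holds   : P ρ′ result
        run     : ∀ (k : ∀ {n} → Sub m n → B n → R n) → evR ρ (κ k) ≡ evR ρ′ (k ω result)

    extends-∘ : ∀ {l m n} {ρ : Env l} {ρ₁ : Env m} {ρ₂ : Env n} {ω₁ : Sub l m} {ω₂ : Sub m n} →
      (∀ i → evalₜ ρ₂ (ω₂ i) ≡ ρ₁ i) → (∀ i → evalₜ ρ₁ (ω₁ i) ≡ ρ i) →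
      ∀ i → evalₜ ρ₂ (sub ω₂ (ω₁ i)) ≡ ρ i
    extends-∘ {ω₁ = ω₁} e₂ e₁ i = trans (eval-sub e₂ (ω₁ i)) (e₁ i)

    module _ (handle : ∀ {m} → Term C m → Cps Lin m)
             (handle-correct : ∀ {m} (ρ : Env m) a →
               Yields ρ (handle a) (λ ρ′ l → evLin x ρ′ l ≡ dist x (evalₜ ρ a))) where

      valuation-correct : ∀ {m} (ρ : Env m) l →
        Yields ρ (valuation handle l) (λ ρ′ l′ → evLin x ρ′ l′ ≡ ext v (evLin x ρ l))
      valuation-correct ρ (a , s) with a CO.≟ 0#
      ... | yes refl = yields var ρ (0# , vₜ s) (λ _ → refl)
              (trans (0⊕∞ x (ext v (evalₜ ρ s))) (sym (cong (ext v) (0⊕∞ x (evalₜ ρ s))))) (λ _ → refl)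
      ... | no a≢0 with handle-correct ρ (λ[ - proj₁ (inverse a a≢0) ] s)
      ...   | yields ω ρ′ l e h r = yields ω ρ′ l e (trans h (root (evalₜ ρ s))) r
        where
        b : Carrier
        b = proj₁ (inverse a a≢0)

        -- With `a * b = 1`, the element `a x + y` is `a` times `x + b y`, and scaling by `a ≠ 0`
        -- does not change the valuation.
        root : ∀ p → dist x (scal∞ (- b) p) ≡ ext v ((↑ (a · x)) ⊕∞ p)
        root ∞     = refl
        root (↑ y) = trans (cong (λ z → v (x ⊕ z)) (trans (-1· _) (trans (cong ⊖_ (·-neg b y)) (⁻¹-involutive (b · y)))))
          (trans (sym (v-scal a _ a≢0)) (cong v (trans (·-distribˡ a x (b · y))
            (cong (a · x ⊕_) (inverse-cancel (proj₂ (inverse a a≢0)) y)))))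

      linearise-correct : ∀ {n m} (ρ : Env m) (ρₛ : Env n) (t : Term C (suc n)) (σ : Sub n m) →
        (∀ i → evalₜ ρ (σ i) ≡ ρₛ i) →
        Yields ρ (linearise handle t σ) (λ ρ′ l → evLin x ρ′ l ≡ evalₜ (cons (↑ x) ρₛ) t)
      linearise-correct ρ ρₛ (var zero) σ e = yields var ρ (1# , 𝟘) (λ _ → refl)
        (cong ↑_ (trans (identityʳ _) (·-identity x))) (λ _ → refl)
      linearise-correct ρ ρₛ (var (suc i)) σ e = yields var ρ (0# , σ i) (λ _ → refl)
        (trans (0⊕∞ x (evalₜ ρ (σ i))) (e i)) (λ _ → refl)
      linearise-correct ρ ρₛ 𝟘 σ e = yields var ρ (0# , 𝟘) (λ _ → refl) (0⊕∞ x (↑ 0g)) (λ _ → refl)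
      linearise-correct ρ ρₛ ∞ₜ σ e = yields var ρ (0# , ∞ₜ) (λ _ → refl) refl (λ _ → refl)
      linearise-correct ρ ρₛ (t ⊞ s) σ e with linearise-correct ρ ρₛ t σ e
      ... | yields ω₁ ρ₁ (a , t′) e₁ h₁ r₁
        with linearise-correct ρ₁ ρₛ s (sub ω₁ ∘ σ) (λ i → trans (eval-sub e₁ (σ i)) (e i))
      ...   | yields ω₂ ρ₂ (b , s′) e₂ h₂ r₂ = yields (sub ω₂ ∘ ω₁) ρ₂ (a + b , sub ω₂ t′ ⊞ s′)
                (extends-∘ {ω₁ = ω₁} e₂ e₁)
              (trans (cong (λ z → (↑ ((a + b) · x)) ⊕∞ (z ⊕∞ evalₜ ρ₂ s′)) (eval-sub e₂ t′))
                (trans (add (evalₜ ρ₁ t′) (evalₜ ρ₂ s′)) (cong₂ _⊕∞_ h₁ h₂)))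
              (λ k → trans (r₁ _) (r₂ _))
        where
        add : ∀ p q → (↑ ((a + b) · x)) ⊕∞ (p ⊕∞ q) ≡ ((↑ (a · x)) ⊕∞ p) ⊕∞ ((↑ (b · x)) ⊕∞ q)
        add ∞     q     = refl
        add (↑ y) ∞     = refl
        add (↑ y) (↑ z) = cong ↑_ (trans (cong (_⊕ (y ⊕ z)) (·-distribʳ a b x))
          (solve 4 (λ ax bx y z → ax :+ bx :+ (y :+ z) := ax :+ y :+ (bx :+ z)) refl (a · x) (b · x) y z))
      linearise-correct ρ ρₛ (λ[ a ] t) σ e with linearise-correct ρ ρₛ t σ e
      ... | yields ω ρ′ (b , t′) e₁ h r = yields ω ρ′ (a * b , λ[ a ] t′) e₁
              (trans (scale (evalₜ ρ′ t′)) (cong (scal∞ a) h)) (λ k → r _)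
        where
        scale : ∀ p → (↑ ((a * b) · x)) ⊕∞ scal∞ a p ≡ scal∞ a ((↑ (b · x)) ⊕∞ p)
        scale ∞     = refl
        scale (↑ y) = cong ↑_ (trans (cong (_⊕ a · y) (·-assoc a b x)) (sym (·-distribˡ a (b · x) y)))
      linearise-correct ρ ρₛ (vₜ t) σ e with linearise-correct ρ ρₛ t σ e
      ... | yields ω₁ ρ₁ l₁ e₁ h₁ r₁ with valuation-correct ρ₁ l₁
      ...   | yields ω₂ ρ₂ l₂ e₂ h₂ r₂ = yields (sub ω₂ ∘ ω₁) ρ₂ l₂
                (extends-∘ {ω₁ = ω₁} e₂ e₁)
              (trans h₂ (cong (ext v) h₁)) (λ k → trans (r₁ _) (r₂ _))

      flatten-correct : ∀ {n m} (ρ : Env m) (ρₛ : Env n) (φ : Q (suc n)) (σ : Sub n m) →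
        (∀ i → evalₜ ρ (σ i) ≡ ρₛ i) →
        Yields ρ (flatten handle φ σ) (λ ρ′ χ → evLF id x ρ′ χ ≡ evQ (cons (↑ x) ρₛ) φ)
      flatten-correct ρ ρₛ (at (t ≺[ o ] s)) σ e with linearise-correct ρ ρₛ t σ e
      ... | yields ω₁ ρ₁ l₁ e₁ h₁ r₁
        with linearise-correct ρ₁ ρₛ s (sub ω₁ ∘ σ) (λ i → trans (eval-sub e₁ (σ i)) (e i))
      ...   | yields ω₂ ρ₂ l₂ e₂ h₂ r₂ = yields (sub ω₂ ∘ ω₁) ρ₂ (less o (subLin ω₂ l₁) l₂)
                (extends-∘ {ω₁ = ω₁} e₂ e₁)
              (trans (less-correct o x ρ₂ (subLin ω₂ l₁) l₂)
                (cong₂ (_<?[ o ]_) (trans (cong ((↑ (proj₁ l₁ · x)) ⊕∞_) (eval-sub e₂ (proj₂ l₁))) h₁) h₂))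
              (λ k → trans (r₁ _) (r₂ _))
      flatten-correct ρ ρₛ true σ e = yields var ρ true (λ _ → refl) refl (λ _ → refl)
      flatten-correct ρ ρₛ (φ & ψ) σ e with flatten-correct ρ ρₛ φ σ e
      ... | yields ω₁ ρ₁ χ₁ e₁ h₁ r₁
        with flatten-correct ρ₁ ρₛ ψ (sub ω₁ ∘ σ) (λ i → trans (eval-sub e₁ (σ i)) (e i))
      ...   | yields ω₂ ρ₂ χ₂ e₂ h₂ r₂ = yields (sub ω₂ ∘ ω₁) ρ₂ (subLF ω₂ χ₁ & χ₂)
                (extends-∘ {ω₁ = ω₁} e₂ e₁)
              (cong₂ _∧_ (trans (evLF-sub id x e₂ χ₁) h₁) h₂)
              (λ k → trans (r₁ _) (r₂ _))
      flatten-correct ρ ρₛ (~ φ) σ e with flatten-correct ρ ρₛ φ σ e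
      ... | yields ω ρ′ χ e₁ h r = yields ω ρ′ (~ χ) e₁ (cong not h) (λ k → r _)


  module _ {I : Set} (order : I → Bool) {n} {x : G} {ρ : Env n} (i : I) (e : Term C n) where
    private
      f : LAtom I n → Bool
      f = evLAtom order x ρ

    is-intro : evalₜ ρ e ≡ ↑ x → T (evLF order x ρ (is i e))
    is-intro h = &-intro f (~ at (lt i e)) (~ at (gt i e))
      (~-intro f (at (lt i e)) λ p → irr (subst (Lift< (R o) (↑ x)) h (atom-elim {o} p)))
      (~-intro f (at (gt i e)) λ p → irr (subst (λ q → Lift< (R o) q (↑ x)) h (atom-elim {o} p)))
      where
      o : Bool
      o = order i
      irr : ¬ Lift< (R o) (↑ x) (↑ x)
      irr = ExtendedOrder.<∞-irrefl (sto o)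

    is-elim : T (evLF order x ρ (is i e)) → evalₜ ρ e ≡ ↑ x
    is-elim p with &-elim f (~ at (lt i e)) (~ at (gt i e)) p | ExtendedOrder.compare∞ (sto (order i)) (evalₜ ρ e) (↑ x)
    ... | _ , m | tri< q _ _ = ⊥-elim (~-elim f (at (gt i e)) m (atom-intro {order i} q))
    ... | _     | tri≈ _ q _ = q
    ... | m , _ | tri> _ _ q = ⊥-elim (~-elim f (at (lt i e)) m (atom-intro {order i} q))

  -- Conditions on a value, reduced to the first order

  module Value {x : G} (vx : v x ≡ ↑ x) where
    open FlattenCorrect (LF Bool) x (evLF id x)

    module _ {m} (ρ : Env m) (a : Term C m) where
      private
        f : LAtom Bool m → Bool
        f = evLAtom id x ρ

        Kont : Set c
        Kont = ∀ {n} → Sub m n → Lin n → LF Bool n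

        module Branches (k : Kont) where
          infinite equal smaller larger unequal fin : LF Bool m
          infinite = k var (0# , ∞ₜ)
          equal    = k var (0# , vₜ (vₜ a ⊟ a))
          smaller  = k var (1# , 𝟘)
          larger   = k var (0# , vₜ a)
          unequal  = ite (at (lt false (vₜ a))) smaller larger
          fin      = ite (is false (vₜ a)) equal unequal

        module _ {y} (ea : evalₜ ρ a ≡ ↑ y) where
          va : evalₜ ρ (vₜ a) ≡ v y
          va = cong (ext v) ea

          run-finite : ∀ (k : Kont) → eval f (valueHandler a k) ≡ eval f (Branches.fin k)
          run-finite k = ite-true f (params (finite a)) (Branches.fin k) (Branches.infinite k)
            (T-≡ (sym (evLF-params id x ρ (finite a))) (finite-intro ρ a ea))

          run-unequal : ¬ v y ≡ ↑ x → ∀ (k : Kont) → eval f (valueHandler a k) ≡ eval f (Branches.unequal k)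
          run-unequal n k = trans (run-finite k)
            (ite-false f (is false (vₜ a)) (Branches.equal k) (Branches.unequal k)
              (λ p → n (trans (sym va) (is-elim id false (vₜ a) p))))

          cases : Tri (v y <∞ ↑ x) (v y ≡ ↑ x) (↑ x <∞ v y) →
                  Yields ρ (valueHandler a) (λ ρ′ l → evLin x ρ′ l ≡ dist x (↑ y))
          cases (tri≈ _ q _) = yields var ρ (0# , vₜ (vₜ a ⊟ a)) (λ _ → refl)
            (trans (0⊕∞ x _) (trans (cong (λ p → ext v (ext v p ⊕∞ scal∞ (- 1#) p)) ea)
              (cong (λ p → ext v (p ⊕∞ scal∞ (- 1#) (↑ y))) q)))
            (λ k → trans (run-finite k) (ite-true f (is false (vₜ a)) (Branches.equal k) (Branches.unequal k)
              (is-intro id false (vₜ a) (trans va q))))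
          cases (tri> _ n q) = yields var ρ (1# , 𝟘) (λ _ → refl)
            (trans (cong ↑_ (trans (identityʳ _) (·-identity x))) (sym (trans (dist-↑ x y) (v-value-−< vx q))))
            (λ k → trans (run-unequal n k)
              (ite-true f (at (lt false (vₜ a))) (Branches.smaller k) (Branches.larger k)
                (atom-intro {false} (subst (↑ x <∞_) (sym va) q))))
          cases (tri< q n m) = yields var ρ (0# , vₜ a) (λ _ → refl)
            (trans (0⊕∞ x _) (trans va (sym (trans (dist-↑ x y) (v-value-−> vx q)))))
            (λ k → trans (run-unequal n k)
              (ite-false f (at (lt false (vₜ a))) (Branches.smaller k) (Branches.larger k)
                (λ p → m (subst (↑ x <∞_) va (atom-elim {false} p)))))

      valueHandler-correct : Yields ρ (valueHandler a) (λ ρ′ l → evLin x ρ′ l ≡ dist x (evalₜ ρ a))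
      valueHandler-correct = go (evalₜ ρ a) refl
        where
        go : ∀ p → evalₜ ρ a ≡ p → Yields ρ (valueHandler a) (λ ρ′ l → evLin x ρ′ l ≡ dist x p)
        go ∞ ea = yields var ρ (0# , ∞ₜ) (λ _ → refl) refl
          (λ k → ite-false f (params (finite a)) (Branches.fin k) (Branches.infinite k)
            (λ p → ¬finite ρ a ea (T-≡ (evLF-params id x ρ (finite a)) p)))
        go (↑ y) ea = cases ea (compare∞ (v y) (↑ x))

    module _ {n} (ρ : Env n) where
      private
        f : LAtom ⊤ n → Bool
        f = evLAtom order₀ x ρ

      value-<₁ᶠ-correct : ∀ e → eval f (value-<₁ᶠ e) ≡ (↑ x <?[ true ] evalₜ ρ e)
      value-<₁ᶠ-correct e = cases (evalₜ ρ e) refl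
        where
        positive under equal equal-below : LF ⊤ n
        positive    = params (at (𝟘 ≺[ true ] e))
        under       = at (gt _ (vₜ e))
        equal-below = params (at (vₜ e ≺[ true ] e))
        equal       = is _ (vₜ e) & equal-below

        cases : ∀ p → evalₜ ρ e ≡ p → eval f (value-<₁ᶠ e) ≡ (↑ x <?[ true ] evalₜ ρ e)
        cases ∞ ee = trans
          (ite-false f (params (finite e)) (positive & (under or equal)) true
            (λ p → ¬finite ρ e ee (T-≡ (evLF-params order₀ x ρ (finite e)) p)))
          (cong (↑ x <?[ true ]_) (sym ee))
        cases (↑ s) ee = trans
          (ite-true f (params (finite e)) (positive & (under or equal)) true
            (T-≡ (sym (evLF-params order₀ x ρ (finite e))) (finite-intro ρ e ee)))
          (T-bool (λ p → subst (λ q → T (↑ x <?[ true ] q)) (sym ee) (atom-intro {true} (fin<fin (to p))))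
                  (λ p → from (atom-↑ true (subst (λ q → T (↑ x <?[ true ] q)) ee p))))
          where
          to : T (eval f (positive & (under or equal))) → x <₁ s
          to p with &-elim f positive (under or equal) p
          ... | p₁ , p₂ with or-elim f under equal p₂
          ...   | inj₁ q = value-<₁ vx (atom-↑ true (subst (λ p → T (↑ 0g <?[ true ] p)) ee p₁))
                             (subst (_<∞ ↑ x) (cong (ext v) ee) (atom-elim {false} q))
          ...   | inj₂ q with &-elim f (is _ (vₜ e)) equal-below q
          ...     | q₁ , q₂ = atom-↑ true (subst₂ (λ p q → T (p <?[ true ] q)) (is-elim order₀ _ (vₜ e) q₁) ee q₂)

          from : x <₁ s → T (eval f (positive & (under or equal)))
          from p with value-<₁⁻¹ vx p
          ... | 0<s , vs≤x = &-intro f positive (under or equal)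
            (subst (λ p → T (↑ 0g <?[ true ] p)) (sym ee) (atom-intro {true} (fin<fin 0<s)))
            ([ (λ q → or-introˡ f under equal (atom-intro {false} (subst (_<∞ ↑ x) (sym (cong (ext v) ee)) q)))
             , (λ q → or-introʳ f under equal (&-intro f (is _ (vₜ e)) equal-below
                        (is-intro order₀ _ (vₜ e) (trans (cong (ext v) ee) q))
                        (subst₂ (λ p q → T (p <?[ true ] q)) (sym (trans (cong (ext v) ee) q)) (sym ee)
                          (atom-intro {true} (fin<fin p))))) ]′ vs≤x)

      toOrder₀-correct : ∀ α → eval f (toOrder₀ α) ≡ evLAtom id x ρ α
      toOrder₀-correct (param α)    = refl
      toOrder₀-correct (lt false e) = refl
      toOrder₀-correct (gt false e) = refl
      toOrder₀-correct (lt true e)  = value-<₁ᶠ-correct e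
      toOrder₀-correct (gt true e)  = T-bool to from
        where
        module E₁ = ExtendedOrder sto₁

        cases : ¬ T (eval f (value-<₁ᶠ e)) → ¬ T (eval f (is _ e)) →
          Tri (Lift< _<₁_ (evalₜ ρ e) (↑ x)) (evalₜ ρ e ≡ ↑ x) (Lift< _<₁_ (↑ x) (evalₜ ρ e)) →
          Lift< _<₁_ (evalₜ ρ e) (↑ x)
        cases _ _ (tri< q _ _) = q
        cases _ n (tri≈ _ q _) = ⊥-elim (n (is-intro order₀ _ e q))
        cases n _ (tri> _ _ q) = ⊥-elim (n (T-≡ (sym (value-<₁ᶠ-correct e)) (atom-intro {true} q)))

        to : T (eval f (toOrder₀ (gt true e))) → T (evalₜ ρ e <?[ true ] ↑ x)
        to p with &-elim f (~ value-<₁ᶠ e) (~ is _ e) p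
        ... | p₁ , p₂ = atom-intro {true} (cases (~-elim f (value-<₁ᶠ e) p₁) (~-elim f (is _ e) p₂)
                          (E₁.compare∞ (evalₜ ρ e) (↑ x)))

        from : T (evalₜ ρ e <?[ true ] ↑ x) → T (eval f (toOrder₀ (gt true e)))
        from p = &-intro f (~ value-<₁ᶠ e) (~ is _ e)
          (~-intro f (value-<₁ᶠ e) (λ q → E₁.<∞-irrefl (E₁.<∞-trans (atom-elim {true} p)
            (atom-elim {true} (T-≡ (value-<₁ᶠ-correct e) q)))))
          (~-intro f (is _ e) (λ q → E₁.<∞-irrefl (subst (λ z → Lift< _<₁_ z (↑ x)) (is-elim order₀ _ e q) (atom-elim {true} p))))

      valueForm-correct : ∀ ψ → evLF order₀ x ρ (valueForm ψ) ≡ evQ (cons (↑ x) ρ) ψ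
      valueForm-correct ψ with flatten-correct valueHandler valueHandler-correct ρ ρ ψ var (λ _ → refl)
      ... | yields ω ρ′ χ e h r = trans
        (eval->>= f (Flatten.flatten (LF Bool) valueHandler ψ var (λ _ χ → χ)) toOrder₀)
        (trans (eval-cong (Flatten.flatten (LF Bool) valueHandler ψ var (λ _ χ → χ)) (λ α _ → toOrder₀-correct α))
          (trans (r (λ _ χ → χ)) h))



  -- Positions among the parameters, and quantifiers over values

  values : ∀ {n} → Env n → List (Term C n) → List G
  values ρ []       = []
  values ρ (t ∷ ts) with evalₜ ρ t
  ... | ↑ x = x ∷ values ρ ts
  ... | ∞   = values ρ ts

  ∈-values⁺ : ∀ {n} (ρ : Env n) {ts t x} → t ∈ ts → evalₜ ρ t ≡ ↑ x → x ∈ values ρ ts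
  ∈-values⁺ ρ {t ∷ ts} (here refl) e with evalₜ ρ t
  ∈-values⁺ ρ {t ∷ ts} (here refl) refl | ↑ x = here refl
  ∈-values⁺ ρ {t ∷ ts} (there i) e with evalₜ ρ t
  ... | ↑ _ = there (∈-values⁺ ρ i e)
  ... | ∞   = ∈-values⁺ ρ i e

  ∈-values⁻ : ∀ {n} (ρ : Env n) ts {x} → x ∈ values ρ ts → Σ (Term C n) λ t → t ∈ ts × evalₜ ρ t ≡ ↑ x
  ∈-values⁻ ρ (t ∷ ts) i with evalₜ ρ t in e
  ∈-values⁻ ρ (t ∷ ts) (here refl) | ↑ x = t , here refl , e
  ∈-values⁻ ρ (t ∷ ts) (there i)   | ↑ _ with ∈-values⁻ ρ ts i
  ... | s , j , h = s , there j , h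
  ∈-values⁻ ρ (t ∷ ts) i | ∞ with ∈-values⁻ ρ ts i
  ... | s , j , h = s , there j , h

  data IsPosition {n} (ρ : Env n) : Position n → Ext± G → Set (c ⊔ g) where
    bottom : IsPosition ρ bottom -∞
    after  : ∀ {t x} → evalₜ ρ t ≡ ↑ x → IsPosition ρ (after t) ⟨ x ⟩

  proper-elim : ∀ {n} (ρ : Env n) π → T (evQ ρ (proper π)) → Σ (Ext± G) λ L → ¬ L ≡ +∞ × IsPosition ρ π L
  proper-elim ρ bottom    _ = -∞ , (λ ()) , bottom
  proper-elim ρ (after t) p with finite-elim ρ t p
  ... | x , e = ⟨ x ⟩ , (λ ()) , after e

  proper-intro : ∀ {n} (ρ : Env n) {π L} → IsPosition ρ π L → T (evQ ρ (proper π))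
  proper-intro ρ bottom            = _
  proper-intro ρ (after {t = t} e) = finite-intro ρ t e

  Sep : Bool → G → Ext± G → List G → Set g
  Sep o = Cuts.Sep (sto o)

  position-<-∞ : ∀ {n} (ρ : Env n) o {π L} → IsPosition ρ π L → ∀ e → evalₜ ρ e ≡ ∞ → T (evQ ρ (position-< π o e))
  position-<-∞ ρ o bottom    e h = _
  position-<-∞ ρ o (after q) e h = atom-intro {o} (subst₂ (Lift< (R o)) (sym q) (sym h) fin<∞)

  position-<-intro : ∀ {n} (ρ : Env n) o {π L} → IsPosition ρ π L → ∀ e {r} → evalₜ ρ e ≡ ↑ r →
    below (R o) L r → T (evQ ρ (position-< π o e))
  position-<-intro ρ o bottom    e h _           = _
  position-<-intro ρ o (after q) e h (fin<fin p) = atom-intro {o} (subst₂ (Lift< (R o)) (sym q) (sym h) (fin<fin p))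

  position-<-elim : ∀ {n} (ρ : Env n) o {π L} → IsPosition ρ π L → ∀ e {r} → evalₜ ρ e ≡ ↑ r →
    T (evQ ρ (position-< π o e)) → below (R o) L r
  position-<-elim ρ o bottom    e h p = -∞<fin
  position-<-elim ρ o (after q) e h p = fin<fin (atom-↑ o (subst₂ (λ p q → T (p <?[ o ] q)) q h p))

  module _ {n} (ρ : Env n) (o : Bool) {π L} (isPos : IsPosition ρ π L) (e : Term C n)
           {x S} (sep : Sep o x L S) (complete : ∀ {r} → evalₜ ρ e ≡ ↑ r → r ∈ S) where
    private
      module E = ExtendedOrder (sto o)

      cases : ∀ {ℓ} {A : Set ℓ} →
        (evalₜ ρ e ≡ ∞ → A) →
        (∀ {r} → evalₜ ρ e ≡ ↑ r → R o r x → ¬ below (R o) L r → A) →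
        (∀ {r} → evalₜ ρ e ≡ ↑ r → R o x r → below (R o) L r → A) → A
      cases {A = A} k∞ k< k> = go (evalₜ ρ e) refl
        where
        go : ∀ p → evalₜ ρ e ≡ p → A
        go ∞     h = k∞ h
        go (↑ r) h = [ (λ (p , q) → k< h p q) , (λ (p , q) → k> h p q) ]′ (sep r (complete h))

    position-lt : evQ ρ (position-< π o e) ≡ (↑ x <?[ o ] evalₜ ρ e)
    position-lt = cases
      (λ h → T-bool (λ _ → atom-intro {o} (subst (Lift< (R o) (↑ x)) (sym h) fin<∞)) (λ _ → position-<-∞ ρ o isPos e h))
      (λ h r<x L≮r → T-bool (λ p → ⊥-elim (L≮r (position-<-elim ρ o isPos e h p)))
        (λ p → ⊥-elim (E.<∞-irrefl (E.<∞-trans (fin<fin r<x) (subst (Lift< (R o) (↑ x)) h (atom-elim {o} p))))))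
      (λ h x<r L<r → T-bool (λ _ → atom-intro {o} (subst (Lift< (R o) (↑ x)) (sym h) (fin<fin x<r)))
        (λ _ → position-<-intro ρ o isPos e h L<r))

    position-gt : evQ ρ (~ position-< π o e) ≡ (evalₜ ρ e <?[ o ] ↑ x)
    position-gt = cases
      (λ h → T-bool (λ p → ⊥-elim (~-elim (evAtom ρ) (position-< π o e) p (position-<-∞ ρ o isPos e h)))
        (λ p → ⊥-elim (∞-maximal (subst (λ z → Lift< (R o) z (↑ x)) h (atom-elim {o} p)))))
      (λ h r<x L≮r → T-bool (λ _ → atom-intro {o} (subst (λ z → Lift< (R o) z (↑ x)) (sym h) (fin<fin r<x)))
        (λ _ → ~-intro (evAtom ρ) (position-< π o e) (λ p → L≮r (position-<-elim ρ o isPos e h p))))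
      (λ h x<r L<r → T-bool (λ p → ⊥-elim (~-elim (evAtom ρ) (position-< π o e) p (position-<-intro ρ o isPos e h L<r)))
        (λ p → ⊥-elim (E.<∞-irrefl (E.<∞-trans (fin<fin x<r) (subst (λ z → Lift< (R o) z (↑ x)) h (atom-elim {o} p))))))
      where
      ∞-maximal : ∀ {p} → ¬ Lift< (R o) ∞ p
      ∞-maximal ()

  -- Finite bounds are listed in `S`, where `x` and the position compare alike; infinite bounds lie
  -- above both.
  atPosition-correct : ∀ {I : Set} (order : I → Bool) {n} (ρ : Env n) {π : I → Position n} {L : I → Ext± G} →
    (∀ i → IsPosition ρ (π i) (L i)) → ∀ {x S} → (∀ i → Sep (order i) x (L i) S) →
    ∀ φ → (∀ {e r} → e ∈ terms φ → evalₜ ρ e ≡ ↑ r → r ∈ S) →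
    evQ ρ (φ >>= atPosition order π) ≡ evLF order x ρ φ
  atPosition-correct order ρ {π} isPos {x} sep φ complete =
    trans (eval->>= (evAtom ρ) φ (atPosition order π)) (eval-cong φ agree)
    where
    agree : ∀ α → α ∈ atoms φ → evQ ρ (atPosition order π α) ≡ evLAtom order x ρ α
    agree (param α) _ = refl
    agree (lt i e)  j = position-lt ρ (order i) (isPos i) e (sep i)
                          (complete (∈-concatMap⁺ bounds (lose j (here refl))))
    agree (gt i e)  j = position-gt ρ (order i) (isPos i) e (sep i)
                          (complete (∈-concatMap⁺ bounds (lose j (here refl))))

  anyPosition-elim : ∀ {n} (ρ : Env n) S k → T (evQ ρ (anyPosition S k)) → Σ (Position n) λ π → T (evQ ρ (k π))
  anyPosition-elim ρ S k p with or-elim (evAtom ρ) (k bottom) (any S (k ∘ after)) p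
  ... | inj₁ q = bottom , q
  ... | inj₂ q with any-elim (evAtom ρ) S q
  ...   | s , _ , h = after s , h

  anyPosition-intro : ∀ {n} (ρ : Env n) S k {L} → (L ≡ -∞ ⊎ Σ G λ s → s ∈ values ρ S × L ≡ ⟨ s ⟩) →
    (∀ {π} → IsPosition ρ π L → T (evQ ρ (k π))) → T (evQ ρ (anyPosition S k))
  anyPosition-intro ρ S k (inj₁ refl) h = or-introˡ (evAtom ρ) (k bottom) (any S (k ∘ after)) (h bottom)
  anyPosition-intro ρ S k (inj₂ (s , i , refl)) h with ∈-values⁻ ρ S i
  ... | t , j , e = or-introʳ (evAtom ρ) (k bottom) (any S (k ∘ after)) (any-intro (evAtom ρ) j (h (after e)))

  open Data.List.Membership.DecPropositional (IsStrictTotalOrder._≟_ sto₀) using (_∈?_)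

  module _ {n} (ρ : Env n) (φ : LF ⊤ n) where
    private
      f : Atom n → Bool
      f = evAtom ρ

    exactValue-elim : ∀ s → T (evQ ρ (exactValue φ s)) → Σ G λ x → v x ≡ ↑ x × T (evLF order₀ x ρ φ)
    exactValue-elim s p with &-elim f (finite s) (eq (vₜ s) s & (φ >>= atTerm order₀ s)) p
    ... | p₁ , p₂₃ with &-elim f (eq (vₜ s) s) (φ >>= atTerm order₀ s) p₂₃ | finite-elim ρ s p₁
    ...   | p₂ , p₃ | x , e = x
      , trans (cong (ext v) (sym e)) (trans (eq-elim ρ (vₜ s) s p₂) e)
      , T-≡ (atTerm-correct order₀ ρ s e φ) p₃

    genericValue-elim : Independent → Dense → ∀ π → T (evQ ρ (genericValue φ π)) →
      Σ G λ x → v x ≡ ↑ x × T (evLF order₀ x ρ φ)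
    genericValue-elim ind dense π p with &-elim f (proper π) (φ >>= atPosition order₀ (λ _ → π)) p
    ... | p₁ , p₂ with proper-elim ρ π p₁
    ...   | L , L≢ , isPos with realise-value ind dense L (values ρ (terms φ)) L≢
    ...     | x , vx , sep = x , vx , T-≡ (atPosition-correct order₀ ρ (λ _ → isPos) (λ _ → sep) φ (∈-values⁺ ρ)) p₂

    testValue-elim : Independent → Dense → T (evQ ρ (testValue φ)) →
      Σ G λ x → v x ≡ ↑ x × T (evLF order₀ x ρ φ)
    testValue-elim ind dense p
      with or-elim f (any (terms φ) (exactValue φ)) (anyPosition (terms φ) (genericValue φ)) p
    ... | inj₁ q with any-elim f (terms φ) q
    ...   | s , _ , h = exactValue-elim s h
    testValue-elim ind dense p | inj₂ q with anyPosition-elim ρ (terms φ) (genericValue φ) q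
    ...   | π , h = genericValue-elim ind dense π h

    testValue-intro : ∀ x → v x ≡ ↑ x → T (evLF order₀ x ρ φ) → T (evQ ρ (testValue φ))
    testValue-intro x vx p with x ∈? values ρ (terms φ)
    ... | yes i with ∈-values⁻ ρ (terms φ) i
    ...   | s , j , e = or-introˡ f (any (terms φ) (exactValue φ)) (anyPosition (terms φ) (genericValue φ))
            (any-intro f j (&-intro f (finite s) (eq (vₜ s) s & (φ >>= atTerm order₀ s)) (finite-intro ρ s e)
              (&-intro f (eq (vₜ s) s) (φ >>= atTerm order₀ s)
                (eq-intro ρ (vₜ s) s (trans (cong (ext v) e) (trans vx (sym e))))
                (T-≡ (sym (atTerm-correct order₀ ρ s e φ)) p))))
    testValue-intro x vx p | no ¬i with Cuts₀.greatestBelow x (values ρ (terms φ)) ¬i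
    ... | L , origin , _ , sep = or-introʳ f (any (terms φ) (exactValue φ)) (anyPosition (terms φ) (genericValue φ))
            (anyPosition-intro ρ (terms φ) (genericValue φ) origin λ {π} isPos →
              &-intro f (proper π) (φ >>= atPosition order₀ (λ _ → π)) (proper-intro ρ isPos)
                (T-≡ (sym (atPosition-correct order₀ ρ (λ _ → isPos) (λ _ → sep) φ (∈-values⁺ ρ))) p))

  elimValue-elim : Independent → Dense → ∀ {n} (ρ : Env n) ψ → T (evQ ρ (elimValue ψ)) →
    Σ (Ext∞ G) λ p → ext v p ≡ p × T (evQ (cons p ρ) ψ)
  elimValue-elim ind dense ρ ψ p with or-elim (evAtom ρ) (subQ (inst ∞ₜ) ψ) (testValue (valueForm ψ)) p
  ... | inj₁ q = ∞ , refl , T-≡ (evQ-inst ρ ∞ₜ ψ) q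
  ... | inj₂ q with testValue-elim ρ (valueForm ψ) ind dense q
  ...   | x , vx , h = ↑ x , vx , T-≡ (Value.valueForm-correct vx ρ ψ) h

  elimValue-intro : ∀ {n} (ρ : Env n) ψ p → ext v p ≡ p → T (evQ (cons p ρ) ψ) → T (evQ ρ (elimValue ψ))
  elimValue-intro ρ ψ ∞ _ h =
    or-introˡ (evAtom ρ) (subQ (inst ∞ₜ) ψ) (testValue (valueForm ψ)) (T-≡ (sym (evQ-inst ρ ∞ₜ ψ)) h)
  elimValue-intro ρ ψ (↑ x) vx h = or-introʳ (evAtom ρ) (subQ (inst ∞ₜ) ψ) (testValue (valueForm ψ))
    (testValue-intro ρ (valueForm ψ) x vx (T-≡ (sym (Value.valueForm-correct vx ρ ψ)) h))

  -- Correctness of the elimination under valuation constraints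

  Holds : ∀ {n} → G → Env n → Constraints n → Set (c ⊔ g)
  Holds x ρ = All λ (a , w) → dist x (evalₜ ρ a) ≡ evalₜ ρ w

  module _ {n} (ρ : Env n) where
    private
      f : Atom n → Bool
      f = evAtom ρ

    satisfies-elim : ∀ cs s {x} → evalₜ ρ s ≡ ↑ x → T (evQ ρ (satisfies cs s)) → Holds x ρ cs
    satisfies-elim cs s {x} e p = All.tabulate λ { {a , w} i →
      trans (cong (λ z → ext v (z ⊕∞ scal∞ (- 1#) (evalₜ ρ a))) (sym e))
        (eq-elim ρ (vₜ (s ⊟ a)) w (all-elim f p (a , w) i)) }

    satisfies-intro : ∀ cs s {x} → evalₜ ρ s ≡ ↑ x → Holds x ρ cs → T (evQ ρ (satisfies cs s))
    satisfies-intro cs s {x} e h = all-intro f cs λ { (a , w) i → eq-intro ρ (vₜ (s ⊟ a)) w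
      (trans (cong (λ z → ext v (z ⊕∞ scal∞ (- 1#) (evalₜ ρ a))) e) (All.lookup h i)) }

    centres : Constraints n → List G
    centres cs = values ρ (map proj₁ cs)

    avoids-elim : ∀ cs s {x} → evalₜ ρ s ≡ ↑ x → T (evQ ρ (avoids cs s)) → ¬ x ∈ centres cs
    avoids-elim cs s e p i with ∈-values⁻ ρ (map proj₁ cs) i
    ... | a , j , ea with ∈-map⁻ proj₁ j
    ...   | (a , w) , k , refl with or-elim f (~ finite a) (~ eq s a) (all-elim f p (a , w) k)
    ...     | inj₁ q = ~-elim f (finite a) q (finite-intro ρ a ea)
    ...     | inj₂ q = ~-elim f (eq s a) q (eq-intro ρ s a (trans e (sym ea)))

    avoids-intro : ∀ cs s {x} → evalₜ ρ s ≡ ↑ x → ¬ x ∈ centres cs → T (evQ ρ (avoids cs s))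
    avoids-intro cs s {x} e n = all-intro f cs λ { (a , w) i → avoid a w i (evalₜ ρ a) refl }
      where
      avoid : ∀ a w → (a , w) ∈ cs → ∀ p → evalₜ ρ a ≡ p → T (evQ ρ (~ finite a or ~ eq s a))
      avoid a w i ∞ ea = or-introˡ f (~ finite a) (~ eq s a) (~-intro f (finite a) (¬finite ρ a ea))
      avoid a w i (↑ y) ea = or-introʳ f (~ finite a) (~ eq s a) (~-intro f (eq s a) λ p →
        n (∈-values⁺ ρ (∈-map⁺ proj₁ i) (trans (sym (eq-elim ρ s a p)) e)))

    anyCandidate-elim : ∀ S cs k → T (evQ ρ (anyCandidate S cs k)) → Σ (Term C n) λ b → T (evQ ρ (k b))
    anyCandidate-elim S cs k p with any-elim f S p
    ... | l , _ , q with or-elim f (any cs λ (a , w) → k (l ⊞ w) or k (l ⊟ w)) (any S λ u → k (l ⊞ λ[ ½ ] (u ⊟ l))) q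
    ...   | inj₂ r with any-elim f S r
    ...     | u , _ , h = l ⊞ λ[ ½ ] (u ⊟ l) , h
    anyCandidate-elim S cs k p | l , _ , q | inj₁ r with any-elim f cs r
    ...     | (a , w) , _ , h with or-elim f (k (l ⊞ w)) (k (l ⊟ w)) h
    ...       | inj₁ h′ = l ⊞ w , h′
    ...       | inj₂ h′ = l ⊟ w , h′

    eval-⊟ : ∀ {t s x y} → evalₜ ρ t ≡ ↑ x → evalₜ ρ s ≡ ↑ y → evalₜ ρ (t ⊟ s) ≡ ↑ (x − y)
    eval-⊟ {x = x} {y} et es = trans (cong₂ (λ p q → p ⊕∞ scal∞ (- 1#) q) et es) (cong (λ z → ↑ (x ⊕ z)) (-1· y))

    anyCandidate-intro : ∀ S cs k {a w W b} → (a , w) ∈ cs → evalₜ ρ w ≡ ↑ W → Candidate (values ρ S) W b →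
      (∀ {t} → evalₜ ρ t ≡ ↑ b → T (evQ ρ (k t))) → T (evQ ρ (anyCandidate S cs k))
    anyCandidate-intro S cs k {a} {w} {W} {b} i ew (l , l∈S , form) h with ∈-values⁻ ρ S l∈S
    ... | tₗ , j , el = any-intro f j (by-form form)
      where
      shifts halves : Q n
      shifts = any cs λ (a , w) → k (tₗ ⊞ w) or k (tₗ ⊟ w)
      halves = any S λ u → k (tₗ ⊞ λ[ ½ ] (u ⊟ tₗ))

      by-form : (b ≡ l ⊕ W ⊎ b ≡ l ⊕ (⊖ W)) ⊎ (Σ G λ u → u ∈ values ρ S × b ≡ l ⊕ ½ · (u − l)) →
        T (evQ ρ (shifts or halves))
      by-form (inj₁ (inj₁ e)) = or-introˡ f shifts halves (any-intro f i
        (or-introˡ f (k (tₗ ⊞ w)) (k (tₗ ⊟ w)) (h (trans (cong₂ _⊕∞_ el ew) (cong ↑_ (sym e))))))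
      by-form (inj₁ (inj₂ e)) = or-introˡ f shifts halves (any-intro f i
        (or-introʳ f (k (tₗ ⊞ w)) (k (tₗ ⊟ w)) (h (trans (eval-⊟ {tₗ} {w} el ew) (cong ↑_ (sym e))))))
      by-form (inj₂ (u , u∈S , e)) with ∈-values⁻ ρ S u∈S
      ... | tᵤ , j′ , eu = or-introʳ f shifts halves (any-intro f j′
        (h (trans (cong₂ (λ p q → p ⊕∞ scal∞ ½ q) el (eval-⊟ {tᵤ} {tₗ} eu el)) (cong ↑_ (sym e)))))

    module _ (cs : Constraints n) (φ : LF Bool n) where
      private
        S : List G
        S = values ρ (points cs φ)

        centres⊆S : ∀ a → a ∈ centres cs → a ∈ S
        centres⊆S a i with ∈-values⁻ ρ (map proj₁ cs) i
        ... | t , j , e = ∈-values⁺ ρ (∈-++⁺ˡ j) e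

        complete : ∀ {e r} → e ∈ terms φ → evalₜ ρ e ≡ ↑ r → r ∈ S
        complete i = ∈-values⁺ ρ (∈-++⁺ʳ (map proj₁ cs) i)

        positions-correct : ∀ {π b L y} → IsPosition ρ π L → evalₜ ρ b ≡ ↑ y →
          ∀ o → IsPosition ρ (positions cs φ b π o) (if o then ⟨ y ⟩ else L)
        positions-correct isPos e false = isPos
        positions-correct isPos e true  = after e

        separations : ∀ {x y L} → Sep false x L S → Sep true x ⟨ y ⟩ S →
          ∀ o → Sep o x (if o then ⟨ y ⟩ else L) S
        separations s₀ s₁ false = s₀
        separations s₀ s₁ true  = s₁

      exact-elim : ∀ s → T (evQ ρ (exact cs φ s)) → Σ G λ x → Holds x ρ cs × T (evLF id x ρ φ)
      exact-elim s p with &-elim f (finite s) (satisfies cs s & (φ >>= atTerm id s)) p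
      ... | p₁ , p₂₃ with &-elim f (satisfies cs s) (φ >>= atTerm id s) p₂₃ | finite-elim ρ s p₁
      ...   | p₂ , p₃ | x , e = x , satisfies-elim cs s e p₂ , T-≡ (atTerm-correct id ρ s e φ) p₃

      generic-elim : Independent → ∀ π b → T (evQ ρ (generic cs φ π b)) →
        Σ G λ x → Holds x ρ cs × T (evLF id x ρ φ)
      generic-elim ind π b p with &-elim f (proper π) (finite b & satisfies cs b & avoids cs b & ψ) p
        where
        ψ : Q n
        ψ = φ >>= atPosition id (positions cs φ b π)
      ... | p₁ , q₁ with &-elim f (finite b) (satisfies cs b & avoids cs b & (φ >>= atPosition id (positions cs φ b π))) q₁
      ... | p₂ , q₂ with &-elim f (satisfies cs b) (avoids cs b & (φ >>= atPosition id (positions cs φ b π))) q₂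
      ... | p₃ , q₃ with &-elim f (avoids cs b) (φ >>= atPosition id (positions cs φ b π)) q₃
      ... | p₄ , p₅ with proper-elim ρ π p₁ | finite-elim ρ b p₂
      ... | L , L≢ , isPos | y , e with realise ind L y S S (centres cs) L≢ (avoids-elim cs b e p₄)
      ... | x , s₀ , s₁ , same = x , All.tabulate (λ { {a , w} i → transfer a w i (evalₜ ρ a) refl })
        , T-≡ (atPosition-correct id ρ (positions-correct isPos e) (separations s₀ s₁) φ complete) p₅
        where
        transfer : ∀ a w → (a , w) ∈ cs → ∀ p → evalₜ ρ a ≡ p → dist x p ≡ evalₜ ρ w
        -- An infinite centre is at distance `∞` from every point, so its constraint carries over
        -- unchanged.
        transfer a w i ∞ ea = trans (cong (dist y) (sym ea)) (All.lookup (satisfies-elim cs b e p₃) i)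
        transfer a w i (↑ z) ea = trans (dist-↑ x z) (trans (same z (∈-values⁺ ρ (∈-map⁺ proj₁ i) ea))
          (trans (sym (dist-↑ y z)) (trans (cong (dist y) (sym ea)) (All.lookup (satisfies-elim cs b e p₃) i))))

      elimLinear-elim : Independent → T (evQ ρ (elimLinear cs φ)) → Σ G λ x → Holds x ρ cs × T (evLF id x ρ φ)
      elimLinear-elim ind p with or-elim f (any (points cs φ) (exact cs φ))
          (anyPosition (points cs φ) (someCandidate cs φ)) p
      ... | inj₁ q with any-elim f (points cs φ) q
      ...   | s , _ , h = exact-elim s h
      elimLinear-elim ind p | inj₂ q with anyPosition-elim ρ (points cs φ) (someCandidate cs φ) q
      ...   | π , r with anyCandidate-elim (points cs φ) cs (generic cs φ π) r
      ...     | b , h = generic-elim ind π b h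

      elimLinear-intro : ∀ {a₀} → a₀ ∈ centres cs → ∀ x → Holds x ρ cs → T (evLF id x ρ φ) → T (evQ ρ (elimLinear cs φ))
      elimLinear-intro i₀ x holds h with x ∈? S
      ... | yes i with ∈-values⁻ ρ (points cs φ) i
      ...   | s , j , e = or-introˡ f (any (points cs φ) (exact cs φ))
          (anyPosition (points cs φ) (someCandidate cs φ))
          (any-intro f j (&-intro f (finite s) (satisfies cs s & (φ >>= atTerm id s)) (finite-intro ρ s e)
            (&-intro f (satisfies cs s) (φ >>= atTerm id s) (satisfies-intro cs s e holds)
              (T-≡ (sym (atTerm-correct id ρ s e φ)) h))))
      -- The cut of `x` is imitated separately in each order: by `L` for `<₀`, and by the candidate
      -- `b`, which also keeps the valuations, for `<₁`.
      elimLinear-intro i₀ x holds h | no x∉S with Cuts₀.greatestBelow x S x∉S | candidate centres⊆S x∉S i₀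
      ... | L , origin , _ , s₀ | a , W , a∈ , va , b , cand , s₁ , same with ∈-values⁻ ρ (map proj₁ cs) a∈
      ... | tₐ , j , ea with ∈-map⁻ proj₁ j
      ... | (tₐ , w) , j′ , refl = or-introʳ f (any (points cs φ) (exact cs φ))
          (anyPosition (points cs φ) (someCandidate cs φ))
          (anyPosition-intro ρ (points cs φ) (someCandidate cs φ) origin λ {π} isPos →
            anyCandidate-intro (points cs φ) cs (generic cs φ π) j′ ew cand λ {t} et →
              generic-intro π t isPos et)
        where
        -- The constraint at the nearest centre names the step length, so the semantic candidate is
        -- denoted by a term that the formula tries.
        ew : evalₜ ρ w ≡ ↑ W
        ew = trans (sym (All.lookup holds j′)) (trans (cong (dist x) ea) (trans (dist-↑ x a) va))

        -- If `b` were a centre, then `v (x − b) = v (b − b) = ∞`, so `x = b` would be one of the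
        -- parameters.
        b∉ : ¬ b ∈ centres cs
        b∉ i with trans (sym (same b i)) (trans (cong v (inverseʳ b)) v-zero)
        ... | vx−b = x∉S (subst (_∈ S) (sym (x∙y⁻¹≈ε⇒x≈y x b (proj₁ (v-∞ (x − b)) vx−b))) (centres⊆S b i))

        holds-b : Holds b ρ cs
        holds-b = All.tabulate λ { {a , w} i → transfer a w i (evalₜ ρ a) refl }
          where
          transfer : ∀ a w → (a , w) ∈ cs → ∀ p → evalₜ ρ a ≡ p → dist b p ≡ evalₜ ρ w
          transfer a w i ∞ ea = trans (cong (dist x) (sym ea)) (All.lookup holds i)
          transfer a w i (↑ z) ea = trans (dist-↑ b z) (trans (same z (∈-values⁺ ρ (∈-map⁺ proj₁ i) ea))
            (trans (sym (dist-↑ x z)) (trans (cong (dist x) (sym ea)) (All.lookup holds i))))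

        generic-intro : ∀ π t → IsPosition ρ π L → evalₜ ρ t ≡ ↑ b → T (evQ ρ (generic cs φ π t))
        generic-intro π t isPos et =
          &-intro f (proper π) (finite t & satisfies cs t & avoids cs t & ψ) (proper-intro ρ isPos)
            (&-intro f (finite t) (satisfies cs t & avoids cs t & ψ) (finite-intro ρ t et)
              (&-intro f (satisfies cs t) (avoids cs t & ψ) (satisfies-intro cs t et holds-b)
                (&-intro f (avoids cs t) ψ (avoids-intro cs t et b∉)
                  (T-≡ (sym (atPosition-correct id ρ (positions-correct isPos et) (separations s₀ s₁) φ complete)) h))))
          where
          ψ : Q n
          ψ = φ >>= atPosition id (positions cs φ t π)

  evFlat : ∀ {n} → G → Env n → Flat n → Bool
  evFlat x ρ (leaf φ)   = evLF id x ρ φ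
  evFlat x ρ (bind a X) = evFlat x (cons (dist x (evalₜ ρ a)) ρ) X

  eval-weaken : ∀ {n} p (ρ : Env n) t → evalₜ (cons p ρ) (sub weaken t) ≡ evalₜ ρ t
  eval-weaken p ρ = eval-sub λ _ → refl

  Holds-weaken : ∀ {n x} p {ρ : Env n} {cs} → Holds x ρ cs →
    Holds x (cons p ρ) (weakenAll cs)
  Holds-weaken {x = x} p {ρ} = All.map⁺ ∘ All.map λ { {a , w} h →
    trans (cong (dist x) (eval-weaken p ρ a)) (trans h (sym (eval-weaken p ρ w))) }

  Holds-strengthen : ∀ {n x} p {ρ : Env n} {cs} →
    Holds x (cons p ρ) (weakenAll cs) → Holds x ρ cs
  Holds-strengthen {x = x} p {ρ} = All.map (λ { {a , w} h →
    trans (cong (dist x) (sym (eval-weaken p ρ a))) (trans h (eval-weaken p ρ w)) }) ∘ All.map⁻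

  dist-value : ∀ x p → ext v (dist x p) ≡ dist x p
  dist-value x ∞     = refl
  dist-value x (↑ y) = v-idem _

  elim-elim : Independent → Dense → ∀ {n} (ρ : Env n) X w cs → T (evQ ρ (elim X w cs)) →
    Σ G λ x → Holds x ρ ((𝟘 , w) ∷ cs) × T (evFlat x ρ X)
  elim-elim ind dense ρ (leaf φ) w cs p = elimLinear-elim ρ ((𝟘 , w) ∷ cs) φ ind p
  elim-elim ind dense ρ (bind a X) w cs p with elimValue-elim ind dense ρ (elim X (sub weaken w)
    ((sub weaken a , var zero) ∷ weakenAll cs)) p
  ... | q , _ , h with elim-elim ind dense (cons q ρ) X (sub weaken w)
    ((sub weaken a , var zero) ∷ weakenAll cs) h
  ...   | x , h₀ ∷ hₐ ∷ hs , t = x , trans h₀ (eval-weaken q ρ w) ∷ Holds-strengthen q hs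
    -- The constraint `hₐ` identifies the witness `q` with `v(x - a)`, the value that `evFlat`
    -- assigns to the bound variable.
    , subst (λ z → T (evFlat x (cons z ρ) X)) (trans (sym hₐ) (cong (dist x) (eval-weaken q ρ a))) t

  elim-intro : ∀ {n} (ρ : Env n) X w cs x → Holds x ρ ((𝟘 , w) ∷ cs) → T (evFlat x ρ X) → T (evQ ρ (elim X w cs))
  elim-intro ρ (leaf φ) w cs x h t = elimLinear-intro ρ ((𝟘 , w) ∷ cs) φ (here refl) x h t
  elim-intro ρ (bind a X) w cs x (h₀ ∷ hs) t = elimValue-intro ρ (elim X (sub weaken w) cs′) q (dist-value x (evalₜ ρ a))
    (elim-intro (cons q ρ) X (sub weaken w) cs′ x
      (trans h₀ (sym (eval-weaken q ρ w)) ∷ cong (dist x) (eval-weaken q ρ a) ∷ Holds-weaken q hs) t)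
    where
    q : Ext∞ G
    q = dist x (evalₜ ρ a)
    cs′ : Constraints _
    cs′ = (sub weaken a , var zero) ∷ weakenAll cs

  -- Here `p` is arbitrary, because the translated `ψ` never mentions the reserved variable; the
  -- constraint on `v(x)` ties it down elsewhere.
  flat-correct : ∀ {n} x p (ρ : Env n) ψ → evFlat x (cons p ρ) (flat ψ) ≡ evQ (cons (↑ x) ρ) ψ
  flat-correct x p ρ ψ with flatten-correct nameHandler
      (λ ρ a → yields weaken (cons (dist x (evalₜ ρ a)) ρ) (0# , var zero) (λ _ → refl) (0⊕∞ x _) (λ _ → refl))
      (cons p ρ) ρ ψ weaken (λ _ → refl)
    where
    open FlattenCorrect Flat x (evFlat x)
  ... | FlattenCorrect.yields _ _ _ _ h r = trans (r (λ _ → leaf)) h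

  exists-elim : Independent → Dense → ∀ {n} (ρ : Env n) ψ → T (evQ ρ (exists ψ)) → Σ (Ext∞ G) λ p → T (evQ (cons p ρ) ψ)
  exists-elim ind dense ρ ψ p with or-elim (evAtom ρ) (subQ (inst ∞ₜ) ψ) (elimValue (elim (flat ψ) (var zero) [])) p
  ... | inj₁ q = ∞ , T-≡ (evQ-inst ρ ∞ₜ ψ) q
  ... | inj₂ q with elimValue-elim ind dense ρ (elim (flat ψ) (var zero) []) q
  ...   | w , _ , h with elim-elim ind dense (cons w ρ) (flat ψ) (var zero) [] h
  ...     | x , _ , t = ↑ x , T-≡ (flat-correct x w ρ ψ) t

  exists-intro : ∀ {n} (ρ : Env n) ψ p → T (evQ (cons p ρ) ψ) → T (evQ ρ (exists ψ))
  exists-intro ρ ψ ∞ h = or-introˡ (evAtom ρ) (subQ (inst ∞ₜ) ψ) (elimValue (elim (flat ψ) (var zero) []))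
    (T-≡ (sym (evQ-inst ρ ∞ₜ ψ)) h)
  exists-intro ρ ψ (↑ x) h = or-introʳ (evAtom ρ) (subQ (inst ∞ₜ) ψ) (elimValue (elim (flat ψ) (var zero) []))
    (elimValue-intro ρ (elim (flat ψ) (var zero) []) w (dist-value x (↑ 0g))
      (elim-intro (cons w ρ) (flat ψ) (var zero) [] x (refl ∷ []) (T-≡ (sym (flat-correct x w ρ ψ)) h)))
    where
    w : Ext∞ G
    w = dist x (↑ 0g)

  -- From single quantifiers to all formulas and sentences

  module _ (ind : Independent) (dense : Dense) where

    -- Negations and premises exchange the two directions, so both are proved together.
    toQ-sound    : ∀ {n} (ρ : Env n) φ → Sat ρ φ → T (evQ ρ (toQ φ))
    toQ-complete : ∀ {n} (ρ : Env n) φ → T (evQ ρ (toQ φ)) → Sat ρ φ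

    toQ-sound ρ ⊤ᶠ h = _
    toQ-sound ρ (t ≐ s) h = eq-intro ρ t s h
    toQ-sound ρ (t ≺₀ s) h = atom-intro {false} h
    toQ-sound ρ (t ≺₁ s) h = atom-intro {true} h
    toQ-sound ρ (¬ᶠ φ) h = ~-intro (evAtom ρ) (toQ φ) (h ∘ toQ-complete ρ φ)
    toQ-sound ρ (φ ∧ᶠ ψ) (h , k) = &-intro (evAtom ρ) (toQ φ) (toQ ψ) (toQ-sound ρ φ h) (toQ-sound ρ ψ k)
    toQ-sound ρ (φ ∨ᶠ ψ) (inj₁ h) = or-introˡ (evAtom ρ) (toQ φ) (toQ ψ) (toQ-sound ρ φ h)
    toQ-sound ρ (φ ∨ᶠ ψ) (inj₂ h) = or-introʳ (evAtom ρ) (toQ φ) (toQ ψ) (toQ-sound ρ ψ h)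
    -- Rewriting an implication as a disjunction requires deciding the premise, which its Boolean
    -- translation does.
    toQ-sound ρ (φ ⇒ᶠ ψ) h with T? (evQ ρ (toQ φ))
    ... | yes p = or-introʳ (evAtom ρ) (~ toQ φ) (toQ ψ) (toQ-sound ρ ψ (h (toQ-complete ρ φ p)))
    ... | no ¬p = or-introˡ (evAtom ρ) (~ toQ φ) (toQ ψ) (~-intro (evAtom ρ) (toQ φ) ¬p)
    toQ-sound ρ (∃ᶠ φ) (p , h) = exists-intro ρ (toQ φ) p (toQ-sound (cons p ρ) φ h)
    toQ-sound ρ (∀ᶠ φ) h = ~-intro (evAtom ρ) (exists (~ toQ φ)) λ p →
      let q , n = exists-elim ind dense ρ (~ toQ φ) p
      in ~-elim (evAtom (cons q ρ)) (toQ φ) n (toQ-sound (cons q ρ) φ (h q))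

    toQ-complete ρ ⊤ᶠ h = _
    toQ-complete ρ (t ≐ s) h = eq-elim ρ t s h
    toQ-complete ρ (t ≺₀ s) h = atom-elim {false} h
    toQ-complete ρ (t ≺₁ s) h = atom-elim {true} h
    toQ-complete ρ (¬ᶠ φ) h p = ~-elim (evAtom ρ) (toQ φ) h (toQ-sound ρ φ p)
    toQ-complete ρ (φ ∧ᶠ ψ) h with &-elim (evAtom ρ) (toQ φ) (toQ ψ) h
    ... | p , q = toQ-complete ρ φ p , toQ-complete ρ ψ q
    toQ-complete ρ (φ ∨ᶠ ψ) h with or-elim (evAtom ρ) (toQ φ) (toQ ψ) h
    ... | inj₁ p = inj₁ (toQ-complete ρ φ p)
    ... | inj₂ p = inj₂ (toQ-complete ρ ψ p)
    toQ-complete ρ (φ ⇒ᶠ ψ) h p with or-elim (evAtom ρ) (~ toQ φ) (toQ ψ) h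
    ... | inj₁ n = ⊥-elim (~-elim (evAtom ρ) (toQ φ) n (toQ-sound ρ φ p))
    ... | inj₂ q = toQ-complete ρ ψ q
    toQ-complete ρ (∃ᶠ φ) h with exists-elim ind dense ρ (toQ φ) h
    ... | p , q = p , toQ-complete (cons p ρ) φ q
    -- Reading `∀` as the negation of `∃ ¬` is harmless constructively, since the translation has a
    -- Boolean and hence stable truth value.
    toQ-complete ρ (∀ᶠ φ) h p = toQ-complete (cons p ρ) φ (T-stable λ n →
      ~-elim (evAtom ρ) (exists (~ toQ φ)) h (exists-intro ρ (~ toQ φ) p (~-intro (evAtom (cons p ρ)) (toQ φ) n)))

  fromQ-sound    : ∀ {n} (ρ : Env n) φ → T (evQ ρ φ) → Sat ρ (fromQ φ)
  fromQ-complete : ∀ {n} (ρ : Env n) φ → Sat ρ (fromQ φ) → T (evQ ρ φ)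

  fromQ-sound ρ (at (t ≺[ false ] s)) h = atom-elim {false} h
  fromQ-sound ρ (at (t ≺[ true ] s))  h = atom-elim {true} h
  fromQ-sound ρ true    h = _
  fromQ-sound ρ (φ & ψ) h with &-elim (evAtom ρ) φ ψ h
  ... | p , q = fromQ-sound ρ φ p , fromQ-sound ρ ψ q
  fromQ-sound ρ (~ φ)   h p = ~-elim (evAtom ρ) φ h (fromQ-complete ρ φ p)

  fromQ-complete ρ (at (t ≺[ false ] s)) h = atom-intro {false} h
  fromQ-complete ρ (at (t ≺[ true ] s))  h = atom-intro {true} h
  fromQ-complete ρ true    h = _
  fromQ-complete ρ (φ & ψ) (p , q) = &-intro (evAtom ρ) φ ψ (fromQ-complete ρ φ p) (fromQ-complete ρ ψ q)
  fromQ-complete ρ (~ φ)   h = ~-intro (evAtom ρ) φ (h ∘ fromQ-sound ρ φ)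

  closed-eval : (ρ : Env 0) (t : Term C 0) → evalₜ ρ t ≡ (if closedFinite t then ↑ 0g else ∞)
  closed-eval ρ 𝟘  = refl
  closed-eval ρ ∞ₜ = refl
  closed-eval ρ (t ⊞ s) rewrite closed-eval ρ t | closed-eval ρ s with closedFinite t | closedFinite s
  ... | true  | true  = cong ↑_ (identityʳ 0g)
  ... | true  | false = refl
  ... | false | _     = refl
  closed-eval ρ (λ[ a ] t) rewrite closed-eval ρ t with closedFinite t
  ... | true  = cong ↑_ (·-zeroʳ a)
  ... | false = refl
  closed-eval ρ (vₜ t) rewrite closed-eval ρ t with closedFinite t
  ... | true  = v-zero
  ... | false = refl

  closedAtom-correct : (ρ : Env 0) (α : Atom 0) → closedAtom α ≡ evAtom ρ α
  closedAtom-correct ρ (t ≺[ o ] s) rewrite closed-eval ρ t | closed-eval ρ s with closedFinite t | closedFinite s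
  ... | true  | true  = T-bool (λ ()) (λ p → ⊥-elim (ExtendedOrder.<∞-irrefl (sto o) (atom-elim {o} p)))
  ... | true  | false = refl
  ... | false | true  = refl
  ... | false | false = refl

  closedQ-correct : (ρ : Env 0) (φ : Q 0) → eval closedAtom φ ≡ evQ ρ φ
  closedQ-correct ρ φ = eval-cong φ λ α _ → closedAtom-correct ρ α

module _ {c} (C : OrderedField c) (g : Level) where
  open Elimination C

  quantifierElimination : QuantifierElimination C g
  quantifierElimination φ = fromQ (toQ φ) , fromQ-quantifierFree (toQ φ) , λ M ρ →
    let open Correctness C (IndepDenseHamel.space M)
        ind   = IndepDenseHamel.independent M
        dense = IndepDenseHamel.dense M
    in (λ h → fromQ-sound ρ (toQ φ) (toQ-sound ind dense ρ φ h))
     , (λ h → toQ-complete ind dense ρ φ (fromQ-complete ρ (toQ φ) h))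

  -- The case split is on a Boolean computed from the sentence alone, so a single answer serves all
  -- models at once.
  complete : Complete C g
  complete φ with eval closedAtom (toQ φ) in e
  ... | true = inj₁ λ M →
    let open Correctness C (IndepDenseHamel.space M)
    in toQ-complete (IndepDenseHamel.independent M) (IndepDenseHamel.dense M) _ φ
         (T-≡ (trans (sym e) (closedQ-correct _ (toQ φ))) _)
  ... | false = inj₂ λ M h →
    let open Correctness C (IndepDenseHamel.space M)
    in T-≡ (trans (sym (closedQ-correct _ (toQ φ))) e)
         (toQ-sound (IndepDenseHamel.independent M) (IndepDenseHamel.dense M) _ φ h)

theorem4p9 : ∀ {c} (C : OrderedField c) (g : Level) →
    QuantifierElimination C g × Complete C g
theorem4p9 C g = quantifierElimination C g , complete C g
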